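{- Let $r\in\mathbb{N}$. For any $m_1,\ldots,m_r\in \mathbb{N}$, $$E(m_1,\ldots,m_r)= \sum_{d_1\mid m_1, \ldots, d_r\mid m_r} \frac{d_1\cdots d_r}{\operatorname{lcm}[d_1,\ldots, d_r]}\, \mu(m_1/d_1)\cdots \mu(m_r/d_r),$$ where $E(m_1,\ldots,m_r)=\frac1{M}\sum_{k=1}^M c_{m_1}(k)\cdots c_{m_r}(k)$ and $M$ is any positive integer divisible by $\operatorname{lcm}[m_1,\ldots,m_r]$.
   Context: $\mathbb{N}=\{1,2,\ldots\}$. $\mu$ is the Möbius function. For $n,k\in\mathbb{N}$ the Ramanujan sum is $c_n(k)=\sum_{1\le j\le n,\ \gcd(j,n)=1}\exp(2\pi i jk/n)$. The sum in the claim runs over all $r$-tuples $(d_1,\ldots,d_r)$ of positive integers with $d_i\mid m_i$ for each $i$. -}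

module Defs where

open import Algebra.Apartness.Bundles using (HeytingCommutativeRing; HeytingField)
import Algebra.Definitions.RawMonoid as RawMonoidDefs
import Algebra.Properties.Ring as RingProperties
open import Algebra.Bundles using (CommutativeRing)
open import Data.Bool.Base using (if_then_else_)
open import Data.Integer.Base as ℤ using (ℤ; +_; -[1+_]; 0ℤ; 1ℤ; -1ℤ)
open import Data.List.Base as List using (List; []; _∷_; applyUpTo; filter; mapMaybe)
import Data.Maybe.Base as Maybe
open import Data.List.Relation.Unary.Unique.DecPropositional using (unique?)
open import Data.Nat.Base as ℕ using (ℕ; zero; suc; _!)
open import Data.Nat.Divisibility using (_∣_; _∣?_; quotient)
open import Data.Nat.GCD using (gcd)
open import Data.Nat.LCM using (lcm)
import Data.Nat.Properties as ℕ
open import Data.Nat.Primality.Factorisation using (factorise; factors)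
open import Data.Product.Base using (∃-syntax; _×_; _,_; proj₁; proj₂)
open import Data.Sum.Base using (_⊎_; inj₁; inj₂)
open import Data.Vec.Base as Vec using (Vec; []; _∷_)
open import Data.Vec.Relation.Unary.All as All using (All; []; _∷_)
open import Level using (_⊔_) renaming (suc to lsuc)
open import Relation.Binary.Core using (Rel)
open import Relation.Binary.Structures using (IsStrictPartialOrder)
open import Relation.Nullary.Decidable using (does; dec⇒maybe)

------------------------------------------------------------------------
-- Arithmetic

-- The list 1, 2, …, n.
[1⋯_] : ℕ → List ℕ
[1⋯ n ] = applyUpTo suc n

productᵛ : ∀ {r} → Vec ℕ r → ℕ
productᵛ = Vec.foldr′ ℕ._*_ 1

productᵛℤ : ∀ {r} → Vec ℤ r → ℤ
productᵛℤ = Vec.foldr′ ℤ._*_ 1ℤ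

lcmᵛ : ∀ {r} → Vec ℕ r → ℕ
lcmᵛ = Vec.foldr′ lcm 1

-- (-1)ᵏ if n is a product of k distinct primes, and 0 if n is not squarefree.
-- The value at 0 is never used.
μ : ℕ → ℤ
μ zero      = 0ℤ
μ n@(suc _) = if does (unique? ℕ._≟_ ps) then -1ℤ ℤ.^ List.length ps else 0ℤ
  where
  ps : List ℕ
  ps = factors (factorise n)

Divisor : ℕ → Set
Divisor m = ∃[ d ] d ∣ m

divisors : (m : ℕ) → List (Divisor m)
divisors m = mapMaybe (λ d → Maybe.map (d ,_) (dec⇒maybe (d ∣? m))) [1⋯ m ]

-- All tuples (d₁, …, dᵣ) with dᵢ ∣ mᵢ.
divisorTuples : ∀ {r} (m : Vec ℕ r) → List (All Divisor m)
divisorTuples []       = [] ∷ []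
divisorTuples (m ∷ ms) = List.cartesianProductWith _∷_ (divisors m) (divisorTuples ms)

entries : ∀ {r} {m : Vec ℕ r} → All Divisor m → Vec ℕ r
entries = All.reduce proj₁

-- The tuple (m₁/d₁, …, mᵣ/dᵣ).
cofactors : ∀ {r} {m : Vec ℕ r} → All Divisor m → Vec ℕ r
cofactors = All.reduce (λ d → quotient (proj₂ d))

------------------------------------------------------------------------
-- Real numbers

record OrderedField c ℓ₁ ℓ₂ : Set (lsuc (c ⊔ ℓ₁ ⊔ ℓ₂)) where
  infix 4 _<_
  field
    heytingField : HeytingField c ℓ₁ ℓ₂

  -- Apartness x # y is the constructive form of x ≠ y.  The trivial ring is
  -- excluded by `invertible⇒#` together with irreflexivity of _#_.
  open HeytingField heytingField public

  field
    _<_                  : Rel Carrier ℓ₂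
    isStrictPartialOrder : IsStrictPartialOrder _≈_ _<_
    #⇒<⊎>                : ∀ {x y} → x # y → x < y ⊎ y < x
    <⇒#                  : ∀ {x y} → x < y → x # y
    +-monoˡ-<            : ∀ z {x y} → x < y → x + z < y + z
    *-pos                : ∀ {x y} → 0# < x → 0# < y → 0# < x * y

  open IsStrictPartialOrder isStrictPartialOrder public
    using (<-respˡ-≈; <-respʳ-≈) renaming (irrefl to <-irrefl; trans to <-trans)

  commutativeRing : CommutativeRing c ℓ₁
  commutativeRing = HeytingCommutativeRing.commutativeRing heytingCommutativeRing

  open RawMonoidDefs (CommutativeRing.+-rawMonoid commutativeRing) public
    using () renaming (_×_ to _·_)

  fromℕ : ℕ → Carrier
  fromℕ n = n · 1#

  fromℤ : ℤ → Carrier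
  fromℤ (+ n)    = fromℕ n
  fromℤ -[1+ n ] = - fromℕ (suc n)

  infix 4 _within_of_ _⟶_

  -- ∣ x − y ∣ < ε
  _within_of_ : Carrier → Carrier → Carrier → Set ℓ₂
  x within ε of y = (y - ε < x) × (x < y + ε)

  _⟶_ : (ℕ → Carrier) → Carrier → Set (c ⊔ ℓ₂)
  u ⟶ l = ∀ ε → 0# < ε → ∃[ N ] (∀ n → N ℕ.≤ n → u n within ε of l)

  Cauchy : (ℕ → Carrier) → Set (c ⊔ ℓ₂)
  Cauchy u = ∀ ε → 0# < ε →
    ∃[ N ] (∀ m n → N ℕ.≤ m → N ℕ.≤ n → u m within ε of u n)

  private
    module R = RingProperties (CommutativeRing.ring commutativeRing)

  1#0 : 1# # 0#
  1#0 = invertible⇒# (1# , trans (*-identityˡ _) 1-0≈1 , trans (*-identityʳ _) 1-0≈1)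
    where
    1-0≈1 : 1# - 0# ≈ 1#
    1-0≈1 = trans (+-congˡ R.-0#≈0#) (+-identityʳ 1#)

  0<1 : 0# < 1#
  0<1 with #⇒<⊎> 1#0
  ... | inj₂ 0<1 = 0<1
  ... | inj₁ 1<0 = <-respʳ-≈ -1*-1≈1 (*-pos 0<-1 0<-1)
    where
    0<-1 : 0# < - 1#
    0<-1 = <-respˡ-≈ (-‿inverseʳ 1#) (<-respʳ-≈ (+-identityˡ (- 1#)) (+-monoˡ-< (- 1#) 1<0))
    -1*-1≈1 : - 1# * - 1# ≈ 1#
    -1*-1≈1 = trans (R.-1*x≈-x (- 1#)) (R.-‿involutive 1#)

  fromℕ-pos : ∀ n → 0# < fromℕ (suc n)
  fromℕ-pos zero    = <-respʳ-≈ (sym (+-identityʳ 1#)) 0<1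
  fromℕ-pos (suc n) = <-trans (fromℕ-pos n)
    (<-respˡ-≈ (+-identityˡ _) (+-monoˡ-< (fromℕ (suc n)) 0<1))

  -- 1/n, with the convention 1/0 = 0 (only used for positive n).
  recip : ℕ → Carrier
  recip zero    = 0#
  recip (suc n) = proj₁ (#⇒invertible (#-sym (<⇒# (fromℕ-pos n))))

-- The real numbers, characterised as a complete Archimedean ordered field.
-- The axioms hold for the classical and for the constructive reals.
record RealNumbers c ℓ₁ ℓ₂ : Set (lsuc (c ⊔ ℓ₁ ⊔ ℓ₂)) where
  field
    orderedField : OrderedField c ℓ₁ ℓ₂

  open OrderedField orderedField public

  field
    archimedean : ∀ x → ∃[ n ] x < fromℕ n
    complete    : ∀ u → Cauchy u → ∃[ l ] u ⟶ l

------------------------------------------------------------------------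
-- Complex numbers

module Complex {c ℓ₁ ℓ₂} (Real : RealNumbers c ℓ₁ ℓ₂) where

  open RealNumbers Real renaming (Carrier to ℝ)

  infix  4 _≈ℂ_ _⟶ℂ_
  infixl 6 _+ℂ_
  infixl 7 _*ℂ_
  infixr 8 _^ℂ_

  record ℂ : Set c where
    constructor _+i_
    field
      re im : ℝ

  open ℂ public

  _≈ℂ_ : Rel ℂ ℓ₁
  z ≈ℂ w = (re z ≈ re w) × (im z ≈ im w)

  ofReal : ℝ → ℂ
  ofReal x = x +i 0#

  0ℂ 1ℂ : ℂ
  0ℂ = ofReal 0#
  1ℂ = ofReal 1#

  _+ℂ_ _*ℂ_ : ℂ → ℂ → ℂ
  z +ℂ w = (re z + re w) +i (im z + im w)
  z *ℂ w = (re z * re w - im z * im w) +i (re z * im w + im z * re w)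

  _^ℂ_ : ℂ → ℕ → ℂ
  z ^ℂ zero  = 1ℂ
  z ^ℂ suc n = z *ℂ (z ^ℂ n)

  ∑ : ∀ {a} {A : Set a} → List A → (A → ℂ) → ℂ
  ∑ xs f = List.foldr (λ x s → f x +ℂ s) 0ℂ xs

  ∏ : ∀ {a} {A : Set a} {r} → Vec A r → (A → ℂ) → ℂ
  ∏ xs f = Vec.foldr′ (λ x p → f x *ℂ p) 1ℂ xs

  _⟶ℂ_ : (ℕ → ℂ) → ℂ → Set (c ⊔ ℓ₂)
  u ⟶ℂ l = ((λ n → re (u n)) ⟶ re l) × ((λ n → im (u n)) ⟶ im l)

  -- exp z = ∑ₙ zⁿ / n!
  IsExponential : (ℂ → ℂ) → Set (c ⊔ ℓ₂)
  IsExponential exp = ∀ z →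
    (λ N → ∑ (List.upTo N) (λ n → ofReal (recip (n !)) *ℂ z ^ℂ n)) ⟶ℂ exp z

  IsLeastPositiveZero : (ℝ → ℝ) → ℝ → Set (c ⊔ ℓ₁ ⊔ ℓ₂)
  IsLeastPositiveZero f x =
    (0# < x) × (f x ≈ 0#) × (∀ y → 0# < y → y < x → f y # 0#)

  -- π is the least positive zero of sin t = Im (exp (i t)).
  IsPi : (ℂ → ℂ) → ℝ → Set (c ⊔ ℓ₁ ⊔ ℓ₂)
  IsPi exp = IsLeastPositiveZero (λ t → im (exp (0# +i t)))

  module Ramanujan (exp : ℂ → ℂ) (π : ℝ) where

    -- exp (2πi j k / n)
    root : (n j k : ℕ) → ℂ
    root n j k = exp (0# +i (fromℕ 2 * π * fromℕ (j ℕ.* k) * recip n))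

    ramanujanSum : (n k : ℕ) → ℂ
    ramanujanSum n k =
      ∑ (filter (λ j → gcd j n ℕ.≟ 1) [1⋯ n ]) (λ j → root n j k)

    -- (1/M) ∑_{k=1}^{M} c_{m₁}(k) ⋯ c_{mᵣ}(k)
    E : ∀ {r} → (M : ℕ) → Vec ℕ r → ℂ
    E M m = ofReal (recip M) *ℂ ∑ [1⋯ M ] (λ k → ∏ m (λ mᵢ → ramanujanSum mᵢ k))

  -- (d₁ ⋯ dᵣ / lcm [d₁, …, dᵣ]) μ(m₁/d₁) ⋯ μ(mᵣ/dᵣ)
  divisorTerm : ∀ {r} {m : Vec ℕ r} → All Divisor m → ℂ
  divisorTerm d = ofReal
    (fromℕ (productᵛ (entries d)) * recip (lcmᵛ (entries d))
      * fromℤ (productᵛℤ (Vec.map μ (cofactors d))))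

{-# OPTIONS --safe #-}

-- With e(t) = exp (it), everything rests on four facts: e(s + t) = e(s) e(t), e(-t) is the
-- conjugate of e(t), e(2π) = 1, and 1 - e(2πa/n) is invertible for 0 < a < n.
--
-- For the first, let z and w have components bounded by b.  The N-th partial sums satisfy
-- E_N(z) E_N(w) - E_N(z + w) = ∑ zⁱ wʲ / i! j! over i, j < N with i + j ≥ N.  Its components are
-- at most 2 (E_2N(4b) - E_N(4b)), which tends to 0 because the exponential series converges at 4b.
-- Since sin π = 0, e(π) is its own conjugate, so e(2π) = e(π) e(-π) = 1.  Finally
-- 1 - e(2t) = -2i e(t) sin t, and sin t is apart from 0 for t = πa/n, which lies in (0, π).
--
-- These facts give the orthogonality relation ∑_{j ≤ n} e(2πjk/n) = n [n ∣ k], and together with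
-- ∑_{δ ∣ g} μ(δ) = [g = 1] at g = gcd(j, n) the formula c_n(k) = ∑_{d ∣ n} [d ∣ k] d μ(n/d).
-- Multiplying out, c_{m₁}(k) ⋯ c_{mᵣ}(k) is the sum of [lcm d ∣ k] ∏ dᵢ μ(mᵢ/dᵢ) over the tuples d,
-- and exactly M / lcm d of the numbers k ≤ M are divisible by lcm d.
module Submission where

open import Defs
open import Data.Nat using (ℕ; NonZero)
open import Data.Nat.Divisibility using (_∣_)
open import Data.Vec using (Vec)
open import Data.Vec.Relation.Unary.All using (All)

open import Algebra.Bundles using (CommutativeRing; RawRing)
import Algebra.Properties.AbelianGroup as AbelianGroupProperties
import Algebra.Properties.Ring as RingProperties
import Algebra.Properties.Semiring.Mult as Mult
import Algebra.Properties.Semiring.Mult.TCOptimised as MultOptimised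
import Algebra.Solver.Ring as Solver
open import Algebra.Solver.Ring.AlmostCommutativeRing using (_-Raw-AlmostCommutative⟶_; fromCommutativeRing)
open import Data.Bool.Base using (if_then_else_)
open import Data.Integer.Base as ℤ using (ℤ; +_; -[1+_]; 0ℤ; -1ℤ; _⊖_; _◃_)
import Data.Integer.Properties as ℤ
open import Data.List.Base as List using (List; []; _∷_; applyUpTo)
open import Data.List.Membership.Propositional using (_∉_)
open import Data.List.Relation.Binary.Permutation.Propositional using (_↭_; ↭-sym; ↭⇒↭ₛ)
open import Data.List.Relation.Binary.Permutation.Propositional.Properties using (↭-length)
import Data.List.Relation.Binary.Permutation.Setoid.Properties as PermutationProperties
import Data.List.Relation.Unary.All as ListAll
open import Data.List.Relation.Unary.All using ([]; _∷_)
open import Data.List.Relation.Unary.All.Properties using (¬Any⇒All¬; All¬⇒¬Any)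
open import Data.List.Relation.Unary.AllPairs using (_∷_)
open import Data.List.Relation.Unary.Unique.DecPropositional using (unique?)
open import Data.List.Relation.Unary.Unique.Propositional using (Unique)
open import Data.Maybe.Base as Maybe using (Maybe; just; nothing; maybe′)
open import Data.Nat.Base as ℕ using (zero; suc; _∸_; _!; _≤′_; ≤′-refl; ≤′-step; s≤s⁻¹)
open import Data.Nat.Divisibility
  using (_∤_; _∣?_; divides; quotient; quotient-∣; quotient≢0; ∣-trans; 1∣_; 0∣⇒≡0; >⇒∤; ∣⇒≤; ∣m+n∣m⇒∣n;
         ∣m⇒∣m*n; n∣m*n; *-cancelʳ-∣; *-monoˡ-∣; m%n≡0⇒n∣m)
open import Data.Nat.DivMod using (_%_; _/_; m≡m%n+[m/n]*n; m%n<n)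
open import Data.Nat.GCD using (gcd; gcd-greatest; gcd[m,n]∣m; gcd[m,n]∣n; gcd[m,n]≢0)
open import Data.Nat.LCM using (lcm; lcm-least; m∣lcm[m,n]; n∣lcm[m,n])
open import Data.Nat.ListAction using (product)
open import Data.Nat.ListAction.Properties using (∈⇒∣product)
open import Data.Nat.Primality using (Prime; euclidsLemma; prime⇒nonZero)
open import Data.Nat.Primality.Factorisation
  using (PrimeFactorisation; factors; factorise; factorisationUnique; factorisationHasAllPrimeFactors)
import Data.Nat.Properties as ℕ
open import Data.Product.Base using (∃-syntax; _×_; _,_; proj₁; proj₂)
import Data.Sign.Base as Sign
open import Data.Sum.Base using (_⊎_; inj₁; inj₂; [_,_]′)
open import Data.Vec.Base as Vec using ([]; _∷_)
open import Data.Vec.Relation.Unary.All using ([]; _∷_)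
open import Function.Base using (_∘_; id; it)
open import Level using (_⊔_)
import Relation.Binary.PropositionalEquality as ≡
open import Relation.Binary.PropositionalEquality using (_≡_; _≢_)
import Relation.Binary.Reasoning.Setoid as SetoidReasoning
open import Relation.Nullary.Decidable using (Dec; yes; no; dec-true; dec-false; dec⇒maybe)
open import Relation.Nullary.Negation using (¬_; contradiction)
open import Relation.Unary using (Decidable)

open PrimeFactorisation using (isFactorisation; factorsPrime)

-- The reals may be constructive: there is no trichotomy, and neither absolute value, maximum nor
-- modulus is at hand. Weak inequality is the negation `NonNeg`, and sizes are controlled by
-- two-sided bounds on each component. Multiplying such bounds for complex numbers doubles them. One
-- doubling per power turns the bound b into a majorant series at 2b, the Cauchy product of that
-- series with itself lives at 4b, and the products of terms with tails contribute the last factor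
-- 2. The terms of the series enter through the recurrence (n + 1) f (n + 1) = z f n. It makes the
-- Cauchy product of two exponential sequences exponential by a Leibniz rule, in place of the
-- binomial theorem. The function `exp` is known only as a limit at every point, so even its
-- congruence comes from uniqueness of limits, which in turn rests on tightness of the apartness.
-- The arithmetic half works in any commutative ring with an abstract system of roots of unity. Such
-- a ring does not let a nonzero factor be cancelled, hence the demand that 1 - e(2πa/n) be
-- invertible. Divisor sums are handled as sums over 1, ..., n with indicators, where exchanging
-- sums is free of dependent types.

-- A ring solver with integer coefficients

module IntegerCoefficients {c ℓ} (R : CommutativeRing c ℓ) where
  open CommutativeRing R
  open MultOptimised semiring using (1+×; ×-homo-+; ×1-homo-*) renaming (_×_ to _×′_)
  open RingProperties ring
  open SetoidReasoning setoid

  -- With the optimised multiple `_×′_`, `1 ×′ 1#` computes to `1#`. Solver equations can therefore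
  -- contain `1#` and `- 1#` literally, as the values of `con (+ 1)` and `con -[1+ 0 ]`.
  ι : ℤ → Carrier
  ι (+ n)    = n ×′ 1#
  ι -[1+ n ] = - (suc n ×′ 1#)

  ι-⊖ : ∀ m n → ι (m ⊖ n) ≈ m ×′ 1# - n ×′ 1#
  ι-⊖ zero    zero    = sym (-‿inverseʳ 0#)
  ι-⊖ (suc m) zero    = sym (trans (+-congˡ -0#≈0#) (+-identityʳ _))
  ι-⊖ zero    (suc n) = sym (+-identityˡ _)
  ι-⊖ (suc m) (suc n) = begin
    ι (suc m ⊖ suc n)                 ≡⟨ ≡.cong ι (ℤ.[1+m]⊖[1+n]≡m⊖n m n) ⟩
    ι (m ⊖ n)                         ≈⟨ ι-⊖ m n ⟩
    m ×′ 1# - n ×′ 1#                   ≈⟨ +-congʳ (xyx⁻¹≈y 1# (m ×′ 1#)) ⟨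
    (1# + m ×′ 1# - 1#) - n ×′ 1#       ≈⟨ +-assoc _ _ _ ⟩
    1# + m ×′ 1# + (- 1# - n ×′ 1#)     ≈⟨ +-congˡ (-‿+-comm 1# (n ×′ 1#)) ⟩
    1# + m ×′ 1# - (1# + n ×′ 1#)       ≈⟨ +-cong (1+× m 1#) (-‿cong (1+× n 1#)) ⟨
    suc m ×′ 1# - suc n ×′ 1#           ∎

  ι-+ : ∀ i j → ι (i ℤ.+ j) ≈ ι i + ι j
  ι-+ (+ m)    (+ n)    = ×-homo-+ 1# m n
  ι-+ (+ m)    -[1+ n ] = ι-⊖ m (suc n)
  ι-+ -[1+ m ] (+ n)    = trans (ι-⊖ n (suc m)) (+-comm _ _)
  ι-+ -[1+ m ] -[1+ n ] = begin
    - (suc (suc (m ℕ.+ n)) ×′ 1#)   ≡⟨ ≡.cong (λ k → - (k ×′ 1#)) (≡.cong suc (≡.sym (ℕ.+-suc m n))) ⟩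
    - ((suc m ℕ.+ suc n) ×′ 1#)     ≈⟨ -‿cong (×-homo-+ 1# (suc m) (suc n)) ⟩
    - (suc m ×′ 1# + suc n ×′ 1#)    ≈⟨ -‿+-comm _ _ ⟨
    - (suc m ×′ 1#) - (suc n ×′ 1#)  ∎

  ι-+◃ : ∀ n → ι (Sign.+ ◃ n) ≈ n ×′ 1#
  ι-+◃ n = reflexive (≡.cong ι (ℤ.+◃n≡+n n))

  ι--◃ : ∀ n → ι (Sign.- ◃ n) ≈ - (n ×′ 1#)
  ι--◃ zero    = sym -0#≈0#
  ι--◃ (suc n) = refl

  ι-* : ∀ i j → ι (i ℤ.* j) ≈ ι i * ι j
  ι-* (+ m)    (+ n)    = trans (ι-+◃ (m ℕ.* n)) (×1-homo-* m n)
  ι-* (+ m)    -[1+ n ] = trans (ι--◃ (m ℕ.* suc n)) (trans (-‿cong (×1-homo-* m (suc n))) (-‿distribʳ-* _ _))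
  ι-* -[1+ m ] (+ n)    = trans (ι--◃ (suc m ℕ.* n)) (trans (-‿cong (×1-homo-* (suc m) n)) (-‿distribˡ-* _ _))
  ι-* -[1+ m ] -[1+ n ] = begin
    ι (Sign.+ ◃ (suc m ℕ.* suc n))       ≈⟨ ι-+◃ (suc m ℕ.* suc n) ⟩
    (suc m ℕ.* suc n) ×′ 1#               ≈⟨ ×1-homo-* (suc m) (suc n) ⟩
    (suc m ×′ 1#) * (suc n ×′ 1#)          ≈⟨ -‿involutive _ ⟨
    - - ((suc m ×′ 1#) * (suc n ×′ 1#))    ≈⟨ -‿cong (-‿distribˡ-* _ _) ⟩
    - (- (suc m ×′ 1#) * (suc n ×′ 1#))    ≈⟨ -‿distribʳ-* _ _ ⟩
    - (suc m ×′ 1#) * - (suc n ×′ 1#)      ∎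

  ι-neg : ∀ i → ι (ℤ.- i) ≈ - ι i
  ι-neg (+ zero)  = sym -0#≈0#
  ι-neg (+ suc n) = refl
  ι-neg -[1+ n ]  = sym (-‿involutive _)

  private
    ℤ-rawRing : RawRing _ _
    ℤ-rawRing = record
      { _≈_ = _≡_ ; _+_ = ℤ._+_ ; _*_ = ℤ._*_ ; -_ = ℤ.-_ ; 0# = ℤ.0ℤ ; 1# = ℤ.1ℤ }

    morphism : ℤ-rawRing -Raw-AlmostCommutative⟶ fromCommutativeRing R
    morphism = record
      { ⟦_⟧ = ι ; +-homo = ι-+ ; *-homo = ι-* ; -‿homo = ι-neg ; 0-homo = refl ; 1-homo = refl }

    _≟_ : ∀ i j → Maybe (ι i ≈ ι j)
    i ≟ j = Maybe.map (λ i≡j → reflexive (≡.cong ι i≡j)) (dec⇒maybe (i ℤ.≟ j))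

  open Solver ℤ-rawRing (fromCommutativeRing R) morphism _≟_ public
    using (solve; _:=_; _:+_; _:*_; _:-_; :-_; con)

-- Constructive order, two-sided bounds and null sequences

module OrderedFieldProperties {c ℓ₁ ℓ₂} (F : OrderedField c ℓ₁ ℓ₂) where
  open OrderedField F
  open IntegerCoefficients commutativeRing
  open Mult (CommutativeRing.semiring commutativeRing) using (×-homo-+; ×1-homo-*)
  open RingProperties (CommutativeRing.ring commutativeRing) using (-0#≈0#)

  <-resp : ∀ {x x′ y y′} → x ≈ x′ → y ≈ y′ → x < y → x′ < y′
  <-resp x≈x′ y≈y′ x<y = <-respˡ-≈ x≈x′ (<-respʳ-≈ y≈y′ x<y)

  <-asym : ∀ {x y} → x < y → ¬ y < x
  <-asym x<y y<x = <-irrefl refl (<-trans x<y y<x)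

  -- The substitute for trichotomy. Cotransitivity of apartness separates y from x or from z, and if
  -- y lies on the outer side, transitivity through x < z gives the other alternative.
  <-cotrans : ∀ {x z} → x < z → ∀ y → x < y ⊎ y < z
  <-cotrans x<z y with #-cotrans (<⇒# x<z) y
  ... | inj₁ x#y = [ inj₁ , (λ y<x → inj₂ (<-trans y<x x<z)) ]′ (#⇒<⊎> x#y)
  ... | inj₂ y#z = [ inj₂ , (λ z<y → inj₁ (<-trans x<z z<y)) ]′ (#⇒<⊎> y#z)

  <⇒0<- : ∀ {x y} → x < y → 0# < y - x
  <⇒0<- {x} x<y = <-respˡ-≈ (-‿inverseʳ x) (+-monoˡ-< (- x) x<y)

  0<-⇒< : ∀ {x y} → 0# < y - x → x < y
  0<-⇒< {x} {y} 0<y-x = <-resp (+-identityˡ x) (solve 2 (λ x y → y :- x :+ x := y) refl x y) (+-monoˡ-< x 0<y-x)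

  neg-pos : ∀ {x} → x < 0# → 0# < - x
  neg-pos x<0 = <-respʳ-≈ (+-identityˡ _) (<⇒0<- x<0)

  +-pos : ∀ {x y} → 0# < x → 0# < y → 0# < x + y
  +-pos {x} {y} 0<x 0<y = <-trans 0<y (<-respˡ-≈ (+-identityˡ y) (+-monoˡ-< y 0<x))

  -- Apartness from 0 is invertibility, and y times the inverse of x y is an inverse of x.
  *-cancelˡ-# : ∀ {x y} → x * y # 0# → x # 0#
  *-cancelˡ-# {x} {y} xy#0 with #⇒invertible xy#0
  ... | i , ixy≈1 , _ = invertible⇒# (i * y , iyx≈1 , trans (*-comm _ _) iyx≈1)
    where
    iyx≈1 : i * y * (x - 0#) ≈ 1#
    iyx≈1 = trans (solve 3 (λ i x y → i :* y :* (x :- con (+ 0)) := i :* (x :* y :- con (+ 0))) refl i x y) ixy≈1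

  #-resp-≈ : ∀ {x y} → x ≈ y → x # 0# → y # 0#
  #-resp-≈ x≈y x#0 = [ (λ x<0 → <⇒# (<-respˡ-≈ x≈y x<0)) , (λ 0<x → #-sym (<⇒# (<-respʳ-≈ x≈y 0<x))) ]′ (#⇒<⊎> x#0)

  -- Tightness of the apartness: the step that turns order estimates into equations.
  ≮⇒≈0 : ∀ {x} → ¬ 0# < x → ¬ x < 0# → x ≈ 0#
  ≮⇒≈0 x≯0 x≮0 = proj₁ (tight _ _) (λ x#0 → [ x≮0 , x≯0 ]′ (#⇒<⊎> x#0))

  record NonNeg (x : Carrier) : Set ℓ₂ where
    constructor nonNeg
    field ≮0 : ¬ x < 0#

  open NonNeg public

  nonNeg-resp : ∀ {x y} → x ≈ y → NonNeg x → NonNeg y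
  nonNeg-resp x≈y 0≤x .≮0 y<0 = ≮0 0≤x (<-respˡ-≈ (sym x≈y) y<0)

  pos⇒nonNeg : ∀ {x} → 0# < x → NonNeg x
  pos⇒nonNeg 0<x = nonNeg (<-asym 0<x)

  0-nonNeg : NonNeg 0#
  0-nonNeg = nonNeg (<-irrefl refl)

  -- If x + y < 0, comparing with y yields y < 0 or x + y < y, and the latter means x < 0.
  +-nonNeg : ∀ {x y} → NonNeg x → NonNeg y → NonNeg (x + y)
  +-nonNeg {x} {y} 0≤x 0≤y .≮0 x+y<0 with <-cotrans x+y<0 y
  ... | inj₂ y<0   = ≮0 0≤y y<0
  ... | inj₁ x+y<y = ≮0 0≤x (<-resp (solve 2 (λ x y → x :+ y :- y := x) refl x y) (-‿inverseʳ y) (+-monoˡ-< (- y) x+y<y))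

  nonNeg∧#⇒pos : ∀ {x} → NonNeg x → x # 0# → 0# < x
  nonNeg∧#⇒pos 0≤x x#0 = [ (λ x<0 → contradiction x<0 (≮0 0≤x)) , (λ 0<x → 0<x) ]′ (#⇒<⊎> x#0)

  -- A negative product is apart from 0, hence so are both factors. Being nonnegative they are
  -- positive, and so is their product.
  *-nonNeg : ∀ {x y} → NonNeg x → NonNeg y → NonNeg (x * y)
  *-nonNeg {x} {y} 0≤x 0≤y .≮0 xy<0 = <-asym xy<0
    (*-pos (nonNeg∧#⇒pos 0≤x (*-cancelˡ-# xy#0)) (nonNeg∧#⇒pos 0≤y (*-cancelˡ-# (#-resp-≈ (*-comm x y) xy#0))))
    where
    xy#0 : x * y # 0#
    xy#0 = <⇒# xy<0

  nonNeg-cancel : ∀ {k x} → 0# < k → NonNeg (k * x) → NonNeg x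
  nonNeg-cancel {k} {x} 0<k 0≤kx .≮0 x<0 = ≮0 0≤kx (0<-⇒< (<-respʳ-≈
    (solve 2 (λ k x → k :* (:- x) := con (+ 0) :- k :* x) refl k x) (*-pos 0<k (neg-pos x<0))))

  fromℕ-nonNeg : ∀ n → NonNeg (fromℕ n)
  fromℕ-nonNeg zero    = 0-nonNeg
  fromℕ-nonNeg (suc n) = pos⇒nonNeg (fromℕ-pos n)

  fromℕ-+ : ∀ m n → fromℕ (m ℕ.+ n) ≈ fromℕ m + fromℕ n
  fromℕ-+ = ×-homo-+ 1#

  fromℕ-* : ∀ m n → fromℕ (m ℕ.* n) ≈ fromℕ m * fromℕ n
  fromℕ-* = ×1-homo-*

  recip-inverseʳ : ∀ n .{{_ : ℕ.NonZero n}} → fromℕ n * recip n ≈ 1#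
  -- An apartness x # y provides an inverse of x - y, here of x - 0.
  recip-inverseʳ (suc n) = trans (*-congʳ (solve 1 (λ x → x := x :- con (+ 0)) refl (fromℕ (suc n))))
    (proj₂ (proj₂ (#⇒invertible (#-sym (<⇒# (fromℕ-pos n))))))

  recip-pos : ∀ n .{{_ : ℕ.NonZero n}} → 0# < recip n
  recip-pos n@(suc m) = nonNeg∧#⇒pos
    (nonNeg-cancel (fromℕ-pos m) (nonNeg-resp (sym (recip-inverseʳ n)) (pos⇒nonNeg 0<1)))
    (*-cancelˡ-# (#-resp-≈ (trans (sym (recip-inverseʳ n)) (*-comm _ _)) 1#0))

  recip-unique : ∀ n .{{_ : ℕ.NonZero n}} {x} → fromℕ n * x ≈ 1# → x ≈ recip n
  recip-unique n {x} nx≈1 = trans (sym (*-identityˡ x)) (trans (*-congʳ (trans (sym (recip-inverseʳ n)) (*-comm _ _)))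
    (trans (*-assoc _ _ _) (trans (*-congˡ nx≈1) (*-identityʳ _))))

  recip-* : ∀ m n .{{_ : ℕ.NonZero m}} .{{_ : ℕ.NonZero n}} → recip (m ℕ.* n) ≈ recip m * recip n
  recip-* m n = sym (recip-unique (m ℕ.* n) {{ℕ.m*n≢0 m n}}
    (trans (*-congʳ (fromℕ-* m n)) (trans
      (solve 4 (λ a b c d → a :* b :* (c :* d) := (a :* c) :* (b :* d)) refl (fromℕ m) (fromℕ n) (recip m) (recip n))
      (trans (*-cong (recip-inverseʳ m) (recip-inverseʳ n)) (*-identityˡ 1#)))))

  -- x ⊑ b is ∣ x ∣ ≤ b.
  infix 4 _⊑_
  record _⊑_ (x b : Carrier) : Set ℓ₂ where
    constructor _,_
    field
      ⊑⇒≤  : NonNeg (b - x)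
      ⊑⇒-≤ : NonNeg (b + x)

  open _⊑_ public using (⊑⇒≤)

  ⊑-resp : ∀ {x y a b} → x ≈ y → a ≈ b → x ⊑ a → y ⊑ b
  ⊑-resp x≈y a≈b (p , q) = nonNeg-resp (+-cong a≈b (-‿cong x≈y)) p , nonNeg-resp (+-cong a≈b x≈y) q

  nonNeg⇒⊑ : ∀ {x} → NonNeg x → x ⊑ x
  nonNeg⇒⊑ {x} 0≤x = nonNeg-resp (sym (-‿inverseʳ x)) 0-nonNeg , +-nonNeg 0≤x 0≤x

  ⊑-weaken : ∀ {x a b} → x ⊑ a → NonNeg (b - a) → x ⊑ b
  ⊑-weaken {x} {a} {b} (p , q) a≤b =
    nonNeg-resp (solve 3 (λ x a b → (a :- x) :+ (b :- a) := b :- x) refl x a b) (+-nonNeg p a≤b) ,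
    nonNeg-resp (solve 3 (λ x a b → (a :+ x) :+ (b :- a) := b :+ x) refl x a b) (+-nonNeg q a≤b)

  ⊑⇒nonNeg : ∀ {x a} → x ⊑ a → NonNeg a
  ⊑⇒nonNeg {x} {a} (p , q) = nonNeg-cancel (fromℕ-pos 1)
    -- The coefficient is `fromℕ 2` in unfolded form, matching `fromℕ-pos 1`.
    (nonNeg-resp (solve 2 (λ x a → (a :- x) :+ (a :+ x) := (con (+ 1) :+ (con (+ 1) :+ con (+ 0))) :* a) refl x a) (+-nonNeg p q))

  ⊑-+ : ∀ {x y a b} → x ⊑ a → y ⊑ b → x + y ⊑ a + b
  ⊑-+ {x} {y} {a} {b} (p , q) (p′ , q′) =
    nonNeg-resp (solve 4 (λ x y a b → (a :- x) :+ (b :- y) := a :+ b :- (x :+ y)) refl x y a b) (+-nonNeg p p′) ,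
    nonNeg-resp (solve 4 (λ x y a b → (a :+ x) :+ (b :+ y) := a :+ b :+ (x :+ y)) refl x y a b) (+-nonNeg q q′)

  ⊑-neg : ∀ {x a} → x ⊑ a → - x ⊑ a
  ⊑-neg {x} {a} (p , q) = nonNeg-resp (solve 2 (λ x a → a :+ x := a :- (:- x)) refl x a) q , p

  ⊑-cancel : ∀ {k x a} → 0# < k → k * x ⊑ k * a → x ⊑ a
  ⊑-cancel {k} {x} {a} 0<k (p , q) =
    nonNeg-cancel 0<k (nonNeg-resp (solve 3 (λ k x a → k :* a :- k :* x := k :* (a :- x)) refl k x a) p) ,
    nonNeg-cancel 0<k (nonNeg-resp (sym (distribˡ k a x)) q)

  -- Signs are not decidable, so no case distinction is possible. Instead 2(ab - xy) = (a - x)(b +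
  -- y) + (a + x)(b - y), and 2(ab + xy) = (a - x)(b - y) + (a + x)(b + y), with nonnegative
  -- products on the right.
  ⊑-* : ∀ {x y a b} → x ⊑ a → y ⊑ b → x * y ⊑ a * b
  ⊑-* {x} {y} {a} {b} (p , q) (p′ , q′) = ⊑-cancel (+-pos 0<1 0<1)
    ( nonNeg-resp (solve 4 (λ x y a b →
        (a :- x) :* (b :+ y) :+ (a :+ x) :* (b :- y)
          := (con (+ 1) :+ con (+ 1)) :* (a :* b) :- (con (+ 1) :+ con (+ 1)) :* (x :* y)) refl x y a b)
        (+-nonNeg (*-nonNeg p q′) (*-nonNeg q p′))
    , nonNeg-resp (solve 4 (λ x y a b →
        (a :- x) :* (b :- y) :+ (a :+ x) :* (b :+ y)
          := (con (+ 1) :+ con (+ 1)) :* (a :* b) :+ (con (+ 1) :+ con (+ 1)) :* (x :* y)) refl x y a b)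
        (+-nonNeg (*-nonNeg p p′) (*-nonNeg q q′)))

  record Null (u : ℕ → Carrier) : Set (c ⊔ ℓ₂) where
    constructor null
    field eventually : ∀ ε → 0# < ε → ∃[ N ] (∀ n → N ℕ.≤ n → u n ⊑ ε)

  open Null public

  abstract
    ½ : Carrier
    ½ = recip 2

    ½+½≈1 : ½ + ½ ≈ 1#
    ½+½≈1 = trans (sym (trans (distribʳ ½ 1# (1# + 0#))
      (+-cong (*-identityˡ ½) (trans (*-congʳ (+-identityʳ 1#)) (*-identityˡ ½))))) (recip-inverseʳ 2)

    ½-pos : 0# < ½
    ½-pos = recip-pos 2

  ε½+ε½≈ε : ∀ ε → ε * ½ + ε * ½ ≈ ε
  ε½+ε½≈ε ε = trans (sym (distribˡ ε ½ ½)) (trans (*-congˡ ½+½≈1) (*-identityʳ ε))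

  half-pos : ∀ {ε} → 0# < ε → 0# < ε * ½
  half-pos 0<ε = *-pos 0<ε ½-pos

  ⟶⇒null : ∀ {u l} → u ⟶ l → Null (λ n → u n - l)
  ⟶⇒null {u} {l} u⟶l .eventually ε 0<ε = let (N , close) = u⟶l ε 0<ε in
    N , λ n N≤n → let (p , q) = close n N≤n in
    nonNeg-resp (solve 3 (λ u l e → l :+ e :- u := e :- (u :- l)) refl (u n) l ε) (pos⇒nonNeg (<⇒0<- q)) ,
    nonNeg-resp (solve 3 (λ u l e → u :- (l :- e) := e :+ (u :- l)) refl (u n) l ε) (pos⇒nonNeg (<⇒0<- p))

  null-map : ∀ {u v} → (∀ {n ε} → u n ⊑ ε → v n ⊑ ε) → Null u → Null v
  null-map f u→0 .eventually ε 0<ε = let (N , small) = eventually u→0 ε 0<ε in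
    N , λ n N≤n → f (small n N≤n)

  null-resp : ∀ {u v} → (∀ n → u n ≈ v n) → Null u → Null v
  null-resp u≈v = null-map (⊑-resp (u≈v _) refl)

  null-neg : ∀ {u} → Null u → Null (λ n → - u n)
  null-neg = null-map ⊑-neg

  null-dominated : ∀ {u v} → (∀ n → u n ⊑ v n) → Null v → Null u
  null-dominated u⊑v = null-map (λ v⊑ε → ⊑-weaken (u⊑v _) (⊑⇒≤ v⊑ε))

  null-zip : ∀ {u v} {w : ℕ → Set ℓ₂} ε δ → 0# < ε → 0# < δ → (∀ {n} → u n ⊑ ε → v n ⊑ δ → w n) → Null u → Null v →
             ∃[ N ] (∀ n → N ℕ.≤ n → w n)
  null-zip ε δ 0<ε 0<δ f u→0 v→0 =
    let (M , smallᵘ) = eventually u→0 ε 0<ε ; (N , smallᵛ) = eventually v→0 δ 0<δ in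
    M ℕ.+ N , λ n M+N≤n →
      f (smallᵘ n (ℕ.≤-trans (ℕ.m≤m+n M N) M+N≤n)) (smallᵛ n (ℕ.≤-trans (ℕ.m≤n+m N M) M+N≤n))

  null-+ : ∀ {u v} → Null u → Null v → Null (λ n → u n + v n)
  null-+ u→0 v→0 .eventually ε 0<ε = null-zip (ε * ½) (ε * ½) (half-pos 0<ε) (half-pos 0<ε)
    (λ u⊑ v⊑ → ⊑-resp refl (ε½+ε½≈ε ε) (⊑-+ u⊑ v⊑)) u→0 v→0

  null-* : ∀ {u v} → Null u → Null v → Null (λ n → u n * v n)
  -- The bounds ε and 1 on the two factors multiply to ε, which avoids a square root.
  null-* u→0 v→0 .eventually ε 0<ε = null-zip ε 1# 0<ε 0<1
    (λ u⊑ v⊑ → ⊑-resp refl (*-identityʳ ε) (⊑-* u⊑ v⊑)) u→0 v→0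

  null-subsequence : ∀ {u} (s : ℕ → ℕ) → (∀ n → n ℕ.≤ s n) → Null u → Null (λ n → u (s n))
  null-subsequence s n≤sn u→0 .eventually ε 0<ε = let (N , small) = eventually u→0 ε 0<ε in
    N , λ n N≤n → small (s n) (ℕ.≤-trans N≤n (n≤sn n))

  -- If x were positive, smallness at ε = x/2 would give x ≤ x/2. The same for - x leaves only x =
  -- 0.
  null-const : ∀ {x} → Null (λ _ → x) → x ≈ 0#
  null-const {x} x→0 = ≮⇒≈0 (≯0 x→0) (λ x<0 → ≯0 (null-neg x→0) (neg-pos x<0))
    where
    x/2-x≈-x/2 : ∀ x → x * ½ - x ≈ 0# - x * ½
    x/2-x≈-x/2 x = trans (+-congˡ (-‿cong (sym (ε½+ε½≈ε x))))
      (solve 1 (λ y → y :- (y :+ y) := con (+ 0) :- y) refl (x * ½))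

    ≯0 : ∀ {x} → Null (λ _ → x) → ¬ 0# < x
    ≯0 {x} x→0 0<x = let (N , small) = eventually x→0 (x * ½) (half-pos 0<x) in
      ≮0 (nonNeg-resp (x/2-x≈-x/2 x) (⊑⇒≤ (small N ℕ.≤-refl)))
        (0<-⇒< (<-respʳ-≈ (solve 1 (λ y → y := con (+ 0) :- (con (+ 0) :- y)) refl (x * ½)) (half-pos 0<x)))

-- Products of limits

module ArchimedeanProperties {c ℓ₁ ℓ₂} (F : OrderedField c ℓ₁ ℓ₂)
  (archimedean : ∀ (x : OrderedField.Carrier F) → ∃[ n ] OrderedField._<_ F x (OrderedField.fromℕ F n)) where
  open OrderedField F
  open OrderedFieldProperties F
  open IntegerCoefficients commutativeRing

  -- The sum m + n replaces a maximum, and the additional 1 makes the bound a nonzero natural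
  -- number, so that `null-*ˡ` can divide ε by it.
  fromℕ-bound : ∀ {x} m n → x < fromℕ m → - x < fromℕ n → x ⊑ fromℕ (suc (m ℕ.+ n))
  fromℕ-bound {x} m n x<m -x<n =
    nonNeg-resp (trans (upper 1# x (fromℕ m) (fromℕ n)) (+-congʳ (+-congˡ (sym (fromℕ-+ m n)))))
      (+-nonNeg (pos⇒nonNeg 0<1) (+-nonNeg (pos⇒nonNeg (<⇒0<- x<m)) (fromℕ-nonNeg n))) ,
    nonNeg-resp (trans (lower 1# x (fromℕ m) (fromℕ n)) (+-congʳ (+-congˡ (sym (fromℕ-+ m n)))))
      (+-nonNeg (pos⇒nonNeg 0<1) (+-nonNeg (pos⇒nonNeg (<⇒0<- -x<n)) (fromℕ-nonNeg m)))
    where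
    upper : ∀ e x m n → e + (m - x + n) ≈ e + (m + n) - x
    upper = solve 4 (λ e x m n → e :+ (m :- x :+ n) := e :+ (m :+ n) :- x) refl
    lower : ∀ e x m n → e + (n - - x + m) ≈ e + (m + n) + x
    lower = solve 4 (λ e x m n → e :+ (n :- (:- x) :+ m) := e :+ (m :+ n) :+ x) refl

  bounded : ∀ x → ∃[ n ] x ⊑ fromℕ (suc n)
  bounded x = let (m , x<m) = archimedean x ; (n , -x<n) = archimedean (- x) in
    m ℕ.+ n , fromℕ-bound m n x<m -x<n

  null-*ˡ : ∀ {u} x → Null u → Null (λ n → x * u n)
  null-*ˡ x u→0 .eventually ε 0<ε =
    let (k , x⊑k) = bounded x
        (N , small) = eventually u→0 (recip (suc k) * ε) (*-pos (recip-pos (suc k)) 0<ε) in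
    N , λ n N≤n → ⊑-resp refl
      (trans (sym (*-assoc _ _ _)) (trans (*-congʳ (recip-inverseʳ (suc k))) (*-identityˡ ε)))
      (⊑-* x⊑k (small n N≤n))

  -- uv − ab = (u − a)(v − b) + a(v − b) + b(u − a)
  null-product : ∀ {u v : ℕ → Carrier} {a b} → Null (λ n → u n - a) → Null (λ n → v n - b) → Null (λ n → u n * v n - a * b)
  null-product {u} {v} {a} {b} u→a v→b = null-resp
    (λ n → solve 4 (λ u v a b → (u :- a) :* (v :- b) :+ (a :* (v :- b) :+ b :* (u :- a)) := u :* v :- a :* b) refl (u n) (v n) a b)
    (null-+ (null-* u→a v→b) (null-+ (null-*ˡ a v→b) (null-*ˡ b u→a)))

-- Finite sums, Cauchy products and exponential sequences

module FiniteSums {c ℓ} (R : CommutativeRing c ℓ) where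
  open CommutativeRing R
  open IntegerCoefficients R
  open Mult semiring using (×-homo-+)
  open SetoidReasoning setoid

  S : ℕ → (ℕ → Carrier) → Carrier
  S zero    f = 0#
  S (suc n) f = S n f + f n

  S-cong< : ∀ n {f g} → (∀ i → i ℕ.< n → f i ≈ g i) → S n f ≈ S n g
  S-cong< zero    f≈g = refl
  S-cong< (suc n) f≈g = +-cong (S-cong< n (λ i i<n → f≈g i (ℕ.m<n⇒m<1+n i<n))) (f≈g n ℕ.≤-refl)

  S-cong : ∀ n {f g} → (∀ i → f i ≈ g i) → S n f ≈ S n g
  S-cong n f≈g = S-cong< n (λ i _ → f≈g i)

  S-zero : ∀ n → S n (λ _ → 0#) ≈ 0#
  S-zero zero    = refl
  S-zero (suc n) = trans (+-identityʳ _) (S-zero n)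

  S-+ : ∀ n f g → S n (λ i → f i + g i) ≈ S n f + S n g
  S-+ zero    f g = sym (+-identityˡ 0#)
  S-+ (suc n) f g = trans (+-congʳ (S-+ n f g))
    (solve 4 (λ a b c d → a :+ b :+ (c :+ d) := a :+ c :+ (b :+ d)) refl (S n f) (S n g) (f n) (g n))

  S-*ˡ : ∀ n x f → S n (λ i → x * f i) ≈ x * S n f
  S-*ˡ zero    x f = sym (zeroʳ x)
  S-*ˡ (suc n) x f = trans (+-congʳ (S-*ˡ n x f)) (sym (distribˡ x _ _))

  S-*ʳ : ∀ n x f → S n (λ i → f i * x) ≈ S n f * x
  S-*ʳ n x f = trans (S-cong n (λ i → *-comm (f i) x)) (trans (S-*ˡ n x f) (*-comm x _))

  S-shift : ∀ n f → S (suc n) f ≈ f 0 + S n (f ∘ suc)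
  S-shift zero    f = +-comm 0# (f 0)
  S-shift (suc n) f = trans (+-congʳ (S-shift n f)) (+-assoc _ _ _)

  S-swap : ∀ m n (f : ℕ → ℕ → Carrier) → S m (λ i → S n (f i)) ≈ S n (λ j → S m (λ i → f i j))
  S-swap zero    n f = sym (S-zero n)
  S-swap (suc m) n f = trans (+-congʳ (S-swap m n f)) (sym (S-+ n _ _))

  sumOver : ∀ {a} {A : Set a} → List.List A → (A → Carrier) → Carrier
  sumOver xs f = List.foldr (λ x s → f x + s) 0# xs

  sumOver-applyUpTo : ∀ {a} {A : Set a} (h : ℕ → A) n f → sumOver (applyUpTo h n) f ≈ S n (f ∘ h)
  sumOver-applyUpTo h zero    f = refl
  sumOver-applyUpTo h (suc n) f = trans (+-congˡ (sumOver-applyUpTo (h ∘ suc) n f)) (sym (S-shift n (f ∘ h)))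

  open Mult semiring public using () renaming (_×_ to _·_)

  convolution : (f g : ℕ → Carrier) → ℕ → Carrier
  convolution f g m = S (suc m) (λ i → f i * g (m ∸ i))

  private
    suc∸ : ∀ {m i} → i ℕ.< suc m → suc m ∸ i ≡ suc (m ∸ i)
    suc∸ i≤m = ℕ.+-∸-assoc 1 (s≤s⁻¹ i≤m)

  -- Both sides sum f i * g j over the triangle i + j < n, once along diagonals and once along rows.
  S-convolution : ∀ n f g → S n (convolution f g) ≈ S n (λ i → f i * S (n ∸ i) g)
  S-convolution zero    f g = refl
  S-convolution (suc n) f g = begin
    S n (convolution f g) + convolution f g n
      ≈⟨ +-congʳ (S-convolution n f g) ⟩
    S n (λ i → f i * S (n ∸ i) g) + convolution f g n
      ≈⟨ +-congʳ (+-identityʳ _) ⟨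
    S n (λ i → f i * S (n ∸ i) g) + 0# + convolution f g n
      -- The row i = n is still empty, so it can be inserted as 0. Every row up to n then gains its
      -- entry on the new diagonal i + j = n.
      ≈⟨ +-congʳ (+-congˡ (trans (*-congˡ (reflexive (≡.cong (λ k → S k g) (ℕ.n∸n≡0 n)))) (zeroʳ (f n)))) ⟨
    S (suc n) (λ i → f i * S (n ∸ i) g) + convolution f g n
      ≈⟨ S-+ (suc n) (λ i → f i * S (n ∸ i) g) (λ i → f i * g (n ∸ i)) ⟨
    S (suc n) (λ i → f i * S (n ∸ i) g + f i * g (n ∸ i))
      ≈⟨ S-cong< (suc n) (λ i i≤n → trans (sym (distribˡ (f i) _ _))
           (*-congˡ (reflexive (≡.cong (λ k → S k g) (≡.sym (suc∸ i≤n)))))) ⟩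
    S (suc n) (λ i → f i * S (suc n ∸ i) g) ∎

  -- Removing the triangle from the square leaves in row i the entries n - i ≤ j < n, a tail of g.
  -- In this form the gap is estimated term by term.
  S-*-S∸convolution : ∀ n f g →
    S n f * S n g - S n (convolution f g) ≈ S n (λ i → f i * (S n g - S (n ∸ i) g))
  S-*-S∸convolution n f g = begin
    S n f * S n g - S n (convolution f g)
      ≈⟨ +-cong (S-*ʳ n (S n g) f) (-‿cong (sym (S-convolution n f g))) ⟨
    S n (λ i → f i * S n g) - S n (λ i → f i * S (n ∸ i) g)
      ≈⟨ solve 2 (λ a b → a :- b := a :+ con (-[1+ 0 ]) :* b) refl _ _ ⟩
    S n (λ i → f i * S n g) + - 1# * S n (λ i → f i * S (n ∸ i) g)
      ≈⟨ +-congˡ (S-*ˡ n (- 1#) _) ⟨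
    S n (λ i → f i * S n g) + S n (λ i → - 1# * (f i * S (n ∸ i) g))
      ≈⟨ S-+ n _ _ ⟨
    S n (λ i → f i * S n g + - 1# * (f i * S (n ∸ i) g))
      ≈⟨ S-cong n (λ i → solve 3 (λ a b c → a :* b :+ con (-[1+ 0 ]) :* (a :* c) := a :* (b :- c)) refl (f i) (S n g) (S (n ∸ i) g)) ⟩
    S n (λ i → f i * (S n g - S (n ∸ i) g)) ∎

  -- f n = zⁿ / n!
  record IsExponentialSequence (z : Carrier) (f : ℕ → Carrier) : Set ℓ where
    field
      initial : f 0 ≈ 1#
      step    : ∀ n → (suc n · 1#) * f (suc n) ≈ z * f n

  open IsExponentialSequence public

  -- A Leibniz rule: in the summand f i * g (m + 1 - i) the factor m + 1 is split as i + (m + 1 -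
  -- i). The first share lowers the index of f and produces z, the second lowers that of g and
  -- produces w.
  convolution-exponential : ∀ {z w f g} → IsExponentialSequence z f → IsExponentialSequence w g →
    IsExponentialSequence (z + w) (convolution f g)
  convolution-exponential {f = f} {g} ef eg .initial =
    trans (+-identityˡ _) (trans (*-cong (initial ef) (initial eg)) (*-identityˡ 1#))
  convolution-exponential {z} {w} {f} {g} ef eg .step m = begin
    k (suc m) * convolution f g (suc m)
      ≈⟨ S-*ˡ (2 ℕ.+ m) _ _ ⟨
    S (2 ℕ.+ m) (λ i → k (suc m) * (f i * g (suc m ∸ i)))
      ≈⟨ S-cong< (2 ℕ.+ m) (λ i i<2+m → trans
           (*-congʳ (trans (reflexive (≡.cong k (≡.sym (ℕ.m+[n∸m]≡n (s≤s⁻¹ i<2+m))))) (×-homo-+ 1# i (suc m ∸ i))))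
           (solve 4 (λ a b c d → (a :+ b) :* (c :* d) := a :* c :* d :+ c :* (b :* d)) refl _ _ _ _)) ⟩
    S (2 ℕ.+ m) (λ i → k i * f i * g (suc m ∸ i) + f i * (k (suc m ∸ i) * g (suc m ∸ i)))
      ≈⟨ S-+ (2 ℕ.+ m) _ _ ⟩
    S (2 ℕ.+ m) (λ i → k i * f i * g (suc m ∸ i)) + S (2 ℕ.+ m) (λ i → f i * (k (suc m ∸ i) * g (suc m ∸ i)))
      ≈⟨ +-cong left right ⟩
    z * convolution f g m + w * convolution f g m
      ≈⟨ distribʳ _ z w ⟨
    (z + w) * convolution f g m ∎
    where
    k : ℕ → Carrier
    k n = n · 1#

    left : S (2 ℕ.+ m) (λ i → k i * f i * g (suc m ∸ i)) ≈ z * convolution f g m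
    left = begin
      S (2 ℕ.+ m) (λ i → k i * f i * g (suc m ∸ i))
        -- The summand i = 0 carries the factor `k 0`, which is zero; all others have a positive
        -- index, as the recurrence requires. In `right` it is the summand i = m + 1 that vanishes.
        ≈⟨ S-shift (suc m) _ ⟩
      0# * f 0 * g (suc m) + S (suc m) (λ i → k (suc i) * f (suc i) * g (m ∸ i))
        ≈⟨ +-cong (solve 2 (λ a b → con (+ 0) :* a :* b := con (+ 0)) refl _ _)
             (S-cong (suc m) (λ i → trans (*-congʳ (step ef i)) (*-assoc z _ _))) ⟩
      0# + S (suc m) (λ i → z * (f i * g (m ∸ i)))
        ≈⟨ trans (+-identityˡ _) (S-*ˡ (suc m) z _) ⟩
      z * convolution f g m ∎

    right : S (2 ℕ.+ m) (λ i → f i * (k (suc m ∸ i) * g (suc m ∸ i))) ≈ w * convolution f g m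
    right = begin
      S (suc m) (λ i → f i * (k (suc m ∸ i) * g (suc m ∸ i))) + f (suc m) * (k (m ∸ m) * g (m ∸ m))
        ≈⟨ +-cong
             (S-cong< (suc m) (λ i i<1+m → trans
               (*-congˡ (trans (reflexive (≡.cong (λ j → k j * g j) (suc∸ i<1+m))) (step eg (m ∸ i))))
               (solve 3 (λ a b c → a :* (b :* c) := b :* (a :* c)) refl _ _ _)))
             (trans (*-congˡ (*-congʳ (reflexive (≡.cong k (ℕ.n∸n≡0 m)))))
               (solve 2 (λ a b → a :* (con (+ 0) :* b) := con (+ 0)) refl _ _)) ⟩
      S (suc m) (λ i → w * (f i * g (m ∸ i))) + 0#
        ≈⟨ trans (+-identityʳ _) (S-*ˡ (suc m) w _) ⟩
      w * convolution f g m ∎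

  -- The recurrence determines the sequence as soon as positive integers can be cancelled. This
  -- identifies a Cauchy product with the series of the sum of the arguments.
  exponential-unique : (∀ n {x y} → (suc n · 1#) * x ≈ (suc n · 1#) * y → x ≈ y) →
    ∀ {z f g} → IsExponentialSequence z f → IsExponentialSequence z g → ∀ n → f n ≈ g n
  exponential-unique cancel ef eg zero    = trans (initial ef) (sym (initial eg))
  exponential-unique cancel ef eg (suc n) = cancel n
    (trans (step ef n) (trans (*-congˡ (exponential-unique cancel ef eg n)) (sym (step eg n))))

-- The exponential function

module ComplexRing {c ℓ₁ ℓ₂} (Real : RealNumbers c ℓ₁ ℓ₂) where
  open RealNumbers Real
  open Complex Real
  open IntegerCoefficients commutativeRing

  -ℂ_ : ℂ → ℂ
  -ℂ z = (- re z) +i (- im z)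

  private
    re-assoc : ∀ a b c d e f → (a * c - b * d) * e - (a * d + b * c) * f ≈ a * (c * e - d * f) - b * (c * f + d * e)
    re-assoc = solve 6 (λ a b c d e f →
      (a :* c :- b :* d) :* e :- (a :* d :+ b :* c) :* f := a :* (c :* e :- d :* f) :- b :* (c :* f :+ d :* e)) refl

    im-assoc : ∀ a b c d e f → (a * c - b * d) * f + (a * d + b * c) * e ≈ a * (c * f + d * e) + b * (c * e - d * f)
    im-assoc = solve 6 (λ a b c d e f →
      (a :* c :- b :* d) :* f :+ (a :* d :+ b :* c) :* e := a :* (c :* f :+ d :* e) :+ b :* (c :* e :- d :* f)) refl

    re-distrib : ∀ a b c d e f → a * (c + e) - b * (d + f) ≈ (a * c - b * d) + (a * e - b * f)
    re-distrib = solve 6 (λ a b c d e f →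
      a :* (c :+ e) :- b :* (d :+ f) := (a :* c :- b :* d) :+ (a :* e :- b :* f)) refl

    im-distrib : ∀ a b c d e f → a * (d + f) + b * (c + e) ≈ (a * d + b * c) + (a * f + b * e)
    im-distrib = solve 6 (λ a b c d e f →
      a :* (d :+ f) :+ b :* (c :+ e) := (a :* d :+ b :* c) :+ (a :* f :+ b :* e)) refl

    re-comm : ∀ a b c d → a * c - b * d ≈ c * a - d * b
    re-comm = solve 4 (λ a b c d → a :* c :- b :* d := c :* a :- d :* b) refl

    im-comm : ∀ a b c d → a * d + b * c ≈ c * b + d * a
    im-comm = solve 4 (λ a b c d → a :* d :+ b :* c := c :* b :+ d :* a) refl

    re-identity : ∀ a b → 1# * a - 0# * b ≈ a
    re-identity = solve 2 (λ a b → con (+ 1) :* a :- con (+ 0) :* b := a) refl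

    im-identity : ∀ a b → 1# * b + 0# * a ≈ b
    im-identity = solve 2 (λ a b → con (+ 1) :* b :+ con (+ 0) :* a := b) refl

  ≈ℂ-trans : ∀ {x y z} → x ≈ℂ y → y ≈ℂ z → x ≈ℂ z
  ≈ℂ-trans (p , q) (p′ , q′) = trans p p′ , trans q q′

  *ℂ-comm : ∀ z w → z *ℂ w ≈ℂ w *ℂ z
  *ℂ-comm z w = re-comm (re z) (im z) (re w) (im w) , im-comm (re z) (im z) (re w) (im w)

  *ℂ-cong : ∀ {x y u v} → x ≈ℂ y → u ≈ℂ v → x *ℂ u ≈ℂ y *ℂ v
  *ℂ-cong (p , q) (p′ , q′) =
    +-cong (*-cong p p′) (-‿cong (*-cong q q′)) , +-cong (*-cong p q′) (*-cong q p′)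

  *ℂ-identityˡ : ∀ z → 1ℂ *ℂ z ≈ℂ z
  *ℂ-identityˡ z = re-identity (re z) (im z) , im-identity (re z) (im z)

  *ℂ-distribˡ : ∀ x y z → x *ℂ (y +ℂ z) ≈ℂ x *ℂ y +ℂ x *ℂ z
  *ℂ-distribˡ x y z = re-distrib (re x) (im x) (re y) (im y) (re z) (im z) ,
                      im-distrib (re x) (im x) (re y) (im y) (re z) (im z)

  ℂ-ring : CommutativeRing c ℓ₁
  ℂ-ring = record
    { Carrier = ℂ
    ; _≈_     = _≈ℂ_
    ; _+_     = _+ℂ_
    ; _*_     = _*ℂ_
    ; -_      = -ℂ_
    ; 0#      = 0ℂ
    ; 1#      = 1ℂ
    ; isCommutativeRing = record
      { isRing = record
        { +-isAbelianGroup = record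
          { isGroup = record
            { isMonoid = record
              { isSemigroup = record
                { isMagma = record
                  { isEquivalence = record
                    { refl  = refl , refl
                    ; sym   = λ (p , q) → sym p , sym q
                    ; trans = ≈ℂ-trans
                    }
                  ; ∙-cong = λ (p , q) (p′ , q′) → +-cong p p′ , +-cong q q′
                  }
                ; assoc = λ x y z → +-assoc (re x) (re y) (re z) , +-assoc (im x) (im y) (im z)
                }
              ; identity = (λ z → +-identityˡ (re z) , +-identityˡ (im z)) ,
                           (λ z → +-identityʳ (re z) , +-identityʳ (im z))
              }
            ; inverse = (λ z → -‿inverseˡ (re z) , -‿inverseˡ (im z)) ,
                        (λ z → -‿inverseʳ (re z) , -‿inverseʳ (im z))
            ; ⁻¹-cong = λ (p , q) → -‿cong p , -‿cong q
            }
          ; comm = λ z w → +-comm (re z) (re w) , +-comm (im z) (im w)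
          }
        ; *-cong = *ℂ-cong
        ; *-assoc = λ x y z → re-assoc (re x) (im x) (re y) (im y) (re z) (im z) ,
                              im-assoc (re x) (im x) (re y) (im y) (re z) (im z)
        ; *-identity = *ℂ-identityˡ , (λ z → ≈ℂ-trans (*ℂ-comm z 1ℂ) (*ℂ-identityˡ z))
        ; distrib = *ℂ-distribˡ ,
            (λ x y z → ≈ℂ-trans (*ℂ-comm (y +ℂ z) x) (≈ℂ-trans (*ℂ-distribˡ x y z)
              (+-cong (proj₁ (*ℂ-comm x y)) (proj₁ (*ℂ-comm x z)) , +-cong (proj₂ (*ℂ-comm x y)) (proj₂ (*ℂ-comm x z)))))
        }
      ; *-comm = *ℂ-comm
      }
    }

-- Comparison of sums with nonnegative terms

module DominatedSums {c ℓ₁ ℓ₂} (F : OrderedField c ℓ₁ ℓ₂) where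
  open OrderedField F
  open OrderedFieldProperties F
  open FiniteSums commutativeRing
  open IntegerCoefficients commutativeRing

  S-mono : ∀ n {f g} → (∀ i → i ℕ.< n → NonNeg (g i - f i)) → NonNeg (S n g - S n f)
  S-mono zero    f≤g = nonNeg-resp (sym (-‿inverseʳ 0#)) 0-nonNeg
  S-mono (suc n) {f} {g} f≤g = nonNeg-resp
    (solve 4 (λ a b c d → (a :- b) :+ (c :- d) := a :+ c :- (b :+ d)) refl (S n g) (S n f) (g n) (f n))
    (+-nonNeg (S-mono n (λ i i<n → f≤g i (ℕ.m<n⇒m<1+n i<n))) (f≤g n ℕ.≤-refl))

  S-monoˡ : ∀ {m n f} → (∀ i → NonNeg (f i)) → m ≤′ n → NonNeg (S n f - S m f)
  S-monoˡ 0≤f ≤′-refl = nonNeg-resp (sym (-‿inverseʳ _)) 0-nonNeg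
  S-monoˡ {m} {suc n} {f} 0≤f (≤′-step m≤n) = nonNeg-resp
    (solve 3 (λ a b c → (a :- b) :+ c := a :+ c :- b) refl (S n f) (S m f) (f n))
    (+-nonNeg (S-monoˡ 0≤f m≤n) (0≤f n))

  -- The square i, j < n lies in the triangle i + j < 2n: the rows from n on only add, and each row
  -- i < n has 2n - i ≥ n entries.
  S-convolution-≥ : ∀ n {f g} → (∀ i → NonNeg (f i)) → (∀ i → NonNeg (g i)) →
    NonNeg (S (n ℕ.+ n) (convolution f g) - S n f * S n g)
  S-convolution-≥ n {f} {g} 0≤f 0≤g = nonNeg-resp
    (trans (solve 3 (λ a b c → (a :- b) :+ (b :- c) := a :- c) refl _ _ _)
      (+-cong (sym (S-convolution (n ℕ.+ n) f g)) (-‿cong (S-*ʳ n (S n g) f))))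
    (+-nonNeg (S-monoˡ (λ i → *-nonNeg (0≤f i) (S-nonNeg (n ℕ.+ n ∸ i))) (ℕ.≤⇒≤′ (ℕ.m≤m+n n n)))
      (S-mono n (λ i i<n → nonNeg-resp (x[y-z]≈xy-xz (f i) (S (n ℕ.+ n ∸ i) g) (S n g))
        (*-nonNeg (0≤f i) (S-monoˡ 0≤g (ℕ.≤⇒≤′ (n≤n+n∸i (ℕ.<⇒≤ i<n))))))))
    where
    open RingProperties (CommutativeRing.ring commutativeRing) using (x[y-z]≈xy-xz)

    S-nonNeg : ∀ n → NonNeg (S n g)
    S-nonNeg zero    = 0-nonNeg
    S-nonNeg (suc n) = +-nonNeg (S-nonNeg n) (0≤g n)

    n≤n+n∸i : ∀ {i} → i ℕ.≤ n → n ℕ.≤ n ℕ.+ n ∸ i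
    n≤n+n∸i {i} i≤n = ℕ.≤-trans (ℕ.m≤m+n n (n ∸ i)) (ℕ.≤-reflexive (≡.sym (ℕ.+-∸-assoc n i≤n)))

-- Complex limits and componentwise bounds

module ComplexLimits {c ℓ₁ ℓ₂} (Real : RealNumbers c ℓ₁ ℓ₂) where
  open RealNumbers Real
  open Complex Real
  open ComplexRing Real
  open OrderedFieldProperties orderedField
  open ArchimedeanProperties orderedField archimedean
  open IntegerCoefficients commutativeRing
  private
    module ℂ′ where
      open CommutativeRing ℂ-ring public
      open IntegerCoefficients ℂ-ring public
    module Σℝ = FiniteSums commutativeRing
    module Σℂ = FiniteSums ℂ-ring

  record Nullℂ (u : ℕ → ℂ) : Set (c ⊔ ℓ₂) where
    constructor _,_
    field
      null-re : Null (re ∘ u)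
      null-im : Null (im ∘ u)

  open Nullℂ public

  nullℂ-resp : ∀ {u v} → (∀ n → u n ≈ℂ v n) → Nullℂ u → Nullℂ v
  nullℂ-resp u≈v (p , q) = null-resp (λ n → proj₁ (u≈v n)) p , null-resp (λ n → proj₂ (u≈v n)) q

  nullℂ-+ : ∀ {u v} → Nullℂ u → Nullℂ v → Nullℂ (λ n → u n +ℂ v n)
  nullℂ-+ (p , q) (p′ , q′) = null-+ p p′ , null-+ q q′

  nullℂ-neg : ∀ {u} → Nullℂ u → Nullℂ (λ n → -ℂ u n)
  nullℂ-neg (p , q) = null-neg p , null-neg q

  nullℂ-const : ∀ {x} → Nullℂ (λ _ → x) → x ≈ℂ 0ℂ
  nullℂ-const (p , q) = null-const p , null-const q

  infix 4 _⟶₀_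
  _⟶₀_ : (ℕ → ℂ) → ℂ → Set _
  u ⟶₀ l = Nullℂ (λ n → u n +ℂ (-ℂ l))

  ⟶ℂ⇒⟶₀ : ∀ {u l} → u ⟶ℂ l → u ⟶₀ l
  ⟶ℂ⇒⟶₀ (p , q) = ⟶⇒null p , ⟶⇒null q

  -- The constant a - b is (u - v) - (u - a) + (v - b), hence null. Identities for `exp` are
  -- obtained in this way from comparisons of partial sums.
  limit-unique : ∀ {u v a b} → u ⟶₀ a → v ⟶₀ b → Nullℂ (λ n → u n +ℂ (-ℂ v n)) → a ≈ℂ b
  limit-unique {u} {v} {a} {b} u→a v→b u-v→0 = x∙y⁻¹≈ε⇒x≈y a b
    (nullℂ-const (nullℂ-resp
      (λ n → ℂ′.solve 4 (λ u v a b → (u ℂ′.:- v) ℂ′.:+ ((ℂ′.:- (u ℂ′.:- a)) ℂ′.:+ (v ℂ′.:- b)) ℂ′.:= a ℂ′.:- b) ℂ′.refl (u n) (v n) a b)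
      (nullℂ-+ u-v→0 (nullℂ-+ (nullℂ-neg u→a) v→b))))
    where open AbelianGroupProperties ℂ′.+-abelianGroup using (x∙y⁻¹≈ε⇒x≈y)

  limit-* : ∀ {u v a b} → u ⟶₀ a → v ⟶₀ b → (λ n → u n *ℂ v n) ⟶₀ a *ℂ b
  limit-* {u} {v} {a} {b} (p , q) (p′ , q′) =
    null-resp (λ n → re-identity (re (u n) * re (v n)) (im (u n) * im (v n)) (re a * re b) (im a * im b))
      (null-+ (null-product p p′) (null-neg (null-product q q′))) ,
    null-resp (λ n → im-identity (re (u n) * im (v n)) (im (u n) * re (v n)) (re a * im b) (im a * re b))
      (null-+ (null-product p q′) (null-product q p′))
    where
    re-identity : ∀ x y z w → x - z + - (y - w) ≈ x - y - (z - w)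
    re-identity = solve 4 (λ x y z w → x :- z :+ (:- (y :- w)) := x :- y :- (z :- w)) refl
    im-identity : ∀ x y z w → x - z + (y - w) ≈ x + y - (z + w)
    im-identity = solve 4 (λ x y z w → x :- z :+ (y :- w) := x :+ y :- (z :+ w)) refl

  infix 4 _⊴_
  -- Bounding the components avoids the square root in the modulus; the price is the doubled bound
  -- in `⊴-*`.
  record _⊴_ (z : ℂ) (b : Carrier) : Set ℓ₂ where
    constructor _,_
    field
      re-⊑ : re z ⊑ b
      im-⊑ : im z ⊑ b

  ⊴-resp : ∀ {z w a b} → z ≈ℂ w → a ≈ b → z ⊴ a → w ⊴ b
  ⊴-resp (p , q) a≈b (re⊑ , im⊑) = ⊑-resp p a≈b re⊑ , ⊑-resp q a≈b im⊑

  0⊴0 : 0ℂ ⊴ 0#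
  0⊴0 = nonNeg⇒⊑ 0-nonNeg , nonNeg⇒⊑ 0-nonNeg

  ⊴-+ : ∀ {z w a b} → z ⊴ a → w ⊴ b → z +ℂ w ⊴ a + b
  ⊴-+ (p , q) (p′ , q′) = ⊑-+ p p′ , ⊑-+ q q′

  ⊴-* : ∀ {z w a b} → z ⊴ a → w ⊴ b → z *ℂ w ⊴ a * b + a * b
  ⊴-* (p , q) (p′ , q′) = ⊑-+ (⊑-* p p′) (⊑-neg (⊑-* q q′)) , ⊑-+ (⊑-* p q′) (⊑-* q p′)

  S-⊴ : ∀ n {f F} → (∀ i → f i ⊴ F i) → Σℂ.S n f ⊴ Σℝ.S n F
  S-⊴ zero    f⊴F = 0⊴0
  S-⊴ (suc n) f⊴F = ⊴-+ (S-⊴ n f⊴F) (f⊴F n)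

  tail-⊴ : ∀ {m n f F} → (∀ i → f i ⊴ F i) → m ≤′ n →
    Σℂ.S n f +ℂ (-ℂ Σℂ.S m f) ⊴ Σℝ.S n F - Σℝ.S m F
  tail-⊴ f⊴F ≤′-refl = ⊴-resp (ℂ′.sym (ℂ′.-‿inverseʳ _)) (sym (-‿inverseʳ _)) 0⊴0
  tail-⊴ {m} {suc n} {f} {F} f⊴F (≤′-step m≤n) = ⊴-resp
    (ℂ′.solve 3 (λ a b c → (a ℂ′.:- b) ℂ′.:+ c ℂ′.:= a ℂ′.:+ c ℂ′.:- b) ℂ′.refl (Σℂ.S n f) (Σℂ.S m f) (f n))
    (solve 3 (λ a b c → (a :- b) :+ c := a :+ c :- b) refl (Σℝ.S n F) (Σℝ.S m F) (F n))
    (⊴-+ (tail-⊴ f⊴F m≤n) (f⊴F n))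

  -- The row decomposition `S-*-S∸convolution` holds for the majorants too, so bounding every term
  -- and every tail reproduces the real gap, doubled by `⊴-*`.
  gap-⊴ : ∀ n {f g F G} → (∀ i → f i ⊴ F i) → (∀ i → g i ⊴ G i) →
    Σℂ.S n f *ℂ Σℂ.S n g +ℂ (-ℂ Σℂ.S n (Σℂ.convolution f g)) ⊴
    (Σℝ.S n F * Σℝ.S n G - Σℝ.S n (Σℝ.convolution F G)) + (Σℝ.S n F * Σℝ.S n G - Σℝ.S n (Σℝ.convolution F G))
  gap-⊴ n {f} {g} {F} {G} f⊴F g⊴G = ⊴-resp
    (ℂ′.sym (Σℂ.S-*-S∸convolution n f g))
    (trans (Σℝ.S-+ n _ _) (sym (+-cong (Σℝ.S-*-S∸convolution n F G) (Σℝ.S-*-S∸convolution n F G))))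
    (S-⊴ n (λ i → ⊴-* (f⊴F i) (tail-⊴ g⊴G (ℕ.≤⇒≤′ (ℕ.m∸n≤m n i)))))

-- The addition law of the exponential

module ExponentialLaws {c ℓ₁ ℓ₂} (Real : RealNumbers c ℓ₁ ℓ₂)
  (exp : Complex.ℂ Real → Complex.ℂ Real) (isExponential : Complex.IsExponential Real exp) where
  open RealNumbers Real
  open Complex Real
  open ComplexRing Real
  open ComplexLimits Real
  open OrderedFieldProperties orderedField
  open ArchimedeanProperties orderedField archimedean
  open IntegerCoefficients commutativeRing
  open DominatedSums orderedField
  private
    module ℂ′ where
      open CommutativeRing ℂ-ring public
      open IntegerCoefficients ℂ-ring public
    module Σℝ = FiniteSums commutativeRing
    module Σℂ = FiniteSums ℂ-ring

  ofReal-* : ∀ x y → ofReal (x * y) ≈ℂ ofReal x *ℂ ofReal y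
  ofReal-* x y = solve 2 (λ x y → x :* y := x :* y :- con (+ 0) :* con (+ 0)) refl x y ,
                 solve 2 (λ x y → con (+ 0) := x :* con (+ 0) :+ con (+ 0) :* y) refl x y

  re-real-* : ∀ x z → re (ofReal x *ℂ z) ≈ x * re z
  re-real-* x z = solve 3 (λ x a b → x :* a :- con (+ 0) :* b := x :* a) refl x (re z) (im z)

  im-real-* : ∀ x z → im (ofReal x *ℂ z) ≈ x * im z
  im-real-* x z = solve 3 (λ x a b → x :* b :+ con (+ 0) :* a := x :* b) refl x (re z) (im z)

  ofReal-fromℕ : ∀ n → n Σℂ.· 1ℂ ≈ℂ ofReal (fromℕ n)
  ofReal-fromℕ zero    = ℂ′.refl
  ofReal-fromℕ (suc n) = ℂ′.trans (ℂ′.+-congˡ {1ℂ} (ofReal-fromℕ n)) (refl , +-identityˡ 0#)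

  fromℕ-recip-! : ∀ n → fromℕ (suc n) * recip (suc n !) ≈ recip (n !)
  fromℕ-recip-! n = trans (*-congˡ (recip-* (suc n) (n !) {{_}} {{n ℕ.!≢0}}))
    (trans (sym (*-assoc _ _ _)) (trans (*-congʳ (recip-inverseʳ (suc n))) (*-identityˡ _)))

  term : ℂ → ℕ → ℂ
  term z n = ofReal (recip (n !)) *ℂ z ^ℂ n

  term-exponential : ∀ z → Σℂ.IsExponentialSequence z (term z)
  term-exponential z .Σℂ.initial = ℂ′.trans (*ℂ-comm (ofReal (recip 1)) 1ℂ) (ℂ′.trans (*ℂ-identityˡ (ofReal (recip 1))) (recip1≈1 , refl))
    where
    recip1≈1 : recip 1 ≈ 1#
    recip1≈1 = sym (recip-unique 1 (trans (*-identityʳ _) (+-identityʳ 1#)))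
  term-exponential z .Σℂ.step n = begin
    (suc n Σℂ.· 1ℂ) *ℂ (ofReal (recip (suc n !)) *ℂ (z *ℂ z ^ℂ n))
      ≈⟨ *ℂ-cong (ofReal-fromℕ (suc n)) ℂ′.refl ⟩
    ofReal (fromℕ (suc n)) *ℂ (ofReal (recip (suc n !)) *ℂ (z *ℂ z ^ℂ n))
      ≈⟨ rearrange _ _ _ _ ⟩
    z *ℂ (ofReal (fromℕ (suc n)) *ℂ ofReal (recip (suc n !)) *ℂ z ^ℂ n)
      ≈⟨ *ℂ-cong {z} ℂ′.refl (*ℂ-cong (ofReal-* _ _) ℂ′.refl) ⟨
    z *ℂ (ofReal (fromℕ (suc n) * recip (suc n !)) *ℂ z ^ℂ n)
      ≈⟨ *ℂ-cong {z} ℂ′.refl (*ℂ-cong (fromℕ-recip-! n , refl) ℂ′.refl) ⟩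
    z *ℂ (ofReal (recip (n !)) *ℂ z ^ℂ n) ∎
    where
    open SetoidReasoning ℂ′.setoid
    rearrange : ∀ a b c d → a *ℂ (b *ℂ (c *ℂ d)) ≈ℂ c *ℂ (a *ℂ b *ℂ d)
    rearrange = ℂ′.solve 4 (λ a b c d → a ℂ′.:* (b ℂ′.:* (c ℂ′.:* d)) ℂ′.:= c ℂ′.:* (a ℂ′.:* b ℂ′.:* d)) ℂ′.refl

  -- Real parts of the complex terms, so that convergence of the majorant series can be read off
  -- from `isExponential` at a real argument.
  realTerm : Carrier → ℕ → Carrier
  realTerm x n = re (term (ofReal x) n)

  realTerm-exponential : ∀ x → Σℝ.IsExponentialSequence x (realTerm x)
  realTerm-exponential x .Σℝ.initial = proj₁ (Σℂ.initial (term-exponential (ofReal x)))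
  realTerm-exponential x .Σℝ.step n = begin
    fromℕ (suc n) * realTerm x (suc n)
      ≈⟨ re-real-* (fromℕ (suc n)) (term (ofReal x) (suc n)) ⟨
    re (ofReal (fromℕ (suc n)) *ℂ term (ofReal x) (suc n))
      ≈⟨ proj₁ (*ℂ-cong (ofReal-fromℕ (suc n)) (ℂ′.refl {term (ofReal x) (suc n)})) ⟨
    re ((suc n Σℂ.· 1ℂ) *ℂ term (ofReal x) (suc n))
      ≈⟨ proj₁ (Σℂ.step (term-exponential (ofReal x)) n) ⟩
    re (ofReal x *ℂ term (ofReal x) n)
      ≈⟨ re-real-* x (term (ofReal x) n) ⟩
    x * realTerm x n ∎
    where open SetoidReasoning (CommutativeRing.setoid commutativeRing)

  fromℕ-cancel : ∀ n {x y} → fromℕ (suc n) * x ≈ fromℕ (suc n) * y → x ≈ y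
  fromℕ-cancel n {x} {y} kx≈ky = trans (sym (cancel x)) (trans (*-congˡ kx≈ky) (cancel y))
    where
    cancel : ∀ x → recip (suc n) * (fromℕ (suc n) * x) ≈ x
    cancel x = trans (sym (*-assoc _ _ _))
      (trans (*-congʳ (trans (*-comm _ _) (recip-inverseʳ (suc n)))) (*-identityˡ x))

  ℂ-cancel : ∀ n {x y} → (suc n Σℂ.· 1ℂ) *ℂ x ≈ℂ (suc n Σℂ.· 1ℂ) *ℂ y → x ≈ℂ y
  ℂ-cancel n {x} {y} kx≈ky =
    fromℕ-cancel n (trans (sym (re-real-* _ x)) (trans (proj₁ kx≈ky′) (re-real-* _ y))) ,
    fromℕ-cancel n (trans (sym (im-real-* _ x)) (trans (proj₂ kx≈ky′) (im-real-* _ y)))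
    where
    kx≈ky′ : ofReal (fromℕ (suc n)) *ℂ x ≈ℂ ofReal (fromℕ (suc n)) *ℂ y
    kx≈ky′ = ℂ′.trans (*ℂ-cong (ℂ′.sym (ofReal-fromℕ (suc n))) ℂ′.refl)
      (ℂ′.trans kx≈ky (*ℂ-cong (ofReal-fromℕ (suc n)) ℂ′.refl))

  -- Induction along the recurrence: passing from n to n + 1 multiplies by z and so the bound by 2b,
  -- exactly the growth of the real sequence at `b + b`.
  term-⊴ : ∀ {z b} → z ⊴ b → ∀ n → term z n ⊴ realTerm (b + b) n
  term-⊴ {z} {b} z⊴b zero = ⊴-resp (ℂ′.sym (Σℂ.initial (term-exponential z))) (sym (Σℝ.initial (realTerm-exponential (b + b))))
    (nonNeg⇒⊑ (pos⇒nonNeg 0<1) , ⊑-weaken (nonNeg⇒⊑ 0-nonNeg) (nonNeg-resp (solve 0 (con (+ 1) := con (+ 1) :- con (+ 0)) refl) (pos⇒nonNeg 0<1)))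
  term-⊴ {z} {b} z⊴b (suc n) = divide (⊴-resp (ℂ′.sym (Σℂ.step (term-exponential z) n))
    (trans (sym (distribʳ _ b b)) (sym (Σℝ.step (realTerm-exponential (b + b)) n))) (⊴-* z⊴b (term-⊴ z⊴b n)))
    where
    divide : ∀ {w a} → (suc n Σℂ.· 1ℂ) *ℂ w ⊴ fromℕ (suc n) * a → w ⊴ a
    divide {w} {a} kw⊴ka = let (p , q) = ⊴-resp (*ℂ-cong (ofReal-fromℕ (suc n)) (ℂ′.refl {w})) (refl {fromℕ (suc n) * a}) kw⊴ka in
      ⊑-cancel (fromℕ-pos n) (⊑-resp (re-real-* _ w) refl p) , ⊑-cancel (fromℕ-pos n) (⊑-resp (im-real-* _ w) refl q)

  partialSum : ℂ → ℕ → ℂ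
  partialSum z n = Σℂ.S n (term z)

  partialSum⟶exp : ∀ z → partialSum z ⟶₀ exp z
  partialSum⟶exp z = nullℂ-resp (λ n → ℂ′.+-congʳ { -ℂ exp z} (Σℂ.sumOver-applyUpTo id n (term z))) (⟶ℂ⇒⟶₀ (isExponential z))

  re-S : ∀ n f → re (Σℂ.S n f) ≈ Σℝ.S n (re ∘ f)
  re-S zero    f = refl
  re-S (suc n) f = +-congʳ (re-S n f)

  -- No estimate of x ⁿ / n ! is needed: the series converges since exp is given at real arguments too.
  realTail-null : ∀ x → Null (λ n → Σℝ.S (n ℕ.+ n) (realTerm x) - Σℝ.S n (realTerm x))
  realTail-null x = null-resp (λ n → solve 3 (λ a b l → (a :- l) :+ (:- (b :- l)) := a :- b) refl _ _ l)
    (null-+ (null-subsequence (λ n → n ℕ.+ n) (λ n → ℕ.m≤m+n n n) converges) (null-neg converges))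
    where
    l : Carrier
    l = re (exp (ofReal x))
    converges : Null (λ n → Σℝ.S n (realTerm x) - l)
    converges = null-resp (λ n → +-congʳ (re-S n (term (ofReal x)))) (null-re (partialSum⟶exp (ofReal x)))

  module _ (z w : ℂ) where
    bound : ∃[ b ] z ⊴ b × w ⊴ b
    bound = let (a₁ , p₁) = bounded (re z) ; (a₂ , p₂) = bounded (im z)
                (a₃ , p₃) = bounded (re w) ; (a₄ , p₄) = bounded (im w)
                b₁ = fromℕ (suc a₁) ; b₂ = fromℕ (suc a₂) ; b₃ = fromℕ (suc a₃) ; b₄ = fromℕ (suc a₄) in
      -- The sum stands in for the maximum of the four component bounds; it dominates each because
      -- all are nonnegative.
      (b₁ + b₂) + (b₃ + b₄) ,
      (left (left p₁ (⊑⇒nonNeg p₂)) (+-nonNeg (⊑⇒nonNeg p₃) (⊑⇒nonNeg p₄)) ,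
       left (right p₂ (⊑⇒nonNeg p₁)) (+-nonNeg (⊑⇒nonNeg p₃) (⊑⇒nonNeg p₄))) ,
      (right (left p₃ (⊑⇒nonNeg p₄)) (+-nonNeg (⊑⇒nonNeg p₁) (⊑⇒nonNeg p₂)) ,
       right (right p₄ (⊑⇒nonNeg p₃)) (+-nonNeg (⊑⇒nonNeg p₁) (⊑⇒nonNeg p₂)))
      where
      left : ∀ {x a b} → x ⊑ a → NonNeg b → x ⊑ a + b
      left {x} {a} {b} x⊑a 0≤b = ⊑-weaken x⊑a (nonNeg-resp (solve 2 (λ a b → b := a :+ b :- a) refl a b) 0≤b)
      right : ∀ {x a b} → x ⊑ a → NonNeg b → x ⊑ b + a
      right x⊑a 0≤b = ⊑-resp refl (+-comm _ _) (left x⊑a 0≤b)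

    productGap-null : Nullℂ (λ n → partialSum z n *ℂ partialSum w n +ℂ (-ℂ partialSum (z +ℂ w) n))
    productGap-null = let (b , z⊴b , w⊴b) = bound in dominated (b + b) (term-⊴ z⊴b) (term-⊴ w⊴b)
      where
      module _ (B : Carrier) (z⊴ : ∀ n → term z n ⊴ realTerm B n) (w⊴ : ∀ n → term w n ⊴ realTerm B n) where
        convolution≈ : ∀ n → Σℝ.S n (Σℝ.convolution (realTerm B) (realTerm B)) ≈ Σℝ.S n (realTerm (B + B))
        convolution≈ n = Σℝ.S-cong n (Σℝ.exponential-unique fromℕ-cancel
          (Σℝ.convolution-exponential (realTerm-exponential B) (realTerm-exponential B)) (realTerm-exponential (B + B)))

        complexConvolution≈ : ∀ n → Σℂ.S n (Σℂ.convolution (term z) (term w)) ≈ℂ partialSum (z +ℂ w) n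
        complexConvolution≈ n = Σℂ.S-cong n (Σℂ.exponential-unique ℂ-cancel
          (Σℂ.convolution-exponential (term-exponential z) (term-exponential w)) (term-exponential (z +ℂ w)))

        tail : ℕ → Carrier
        tail n = Σℝ.S (n ℕ.+ n) (realTerm (B + B)) - Σℝ.S n (realTerm (B + B))

        realGap : ℕ → Carrier
        realGap n = Σℝ.S n (realTerm B) * Σℝ.S n (realTerm B) - Σℝ.S n (Σℝ.convolution (realTerm B) (realTerm B))

        -- Tail and gap both subtract the triangle i + j < n. Their difference is the triangle i + j
        -- < 2n minus the square, which is nonnegative by `S-convolution-≥`.
        realGap≤tail : ∀ n → NonNeg (tail n - realGap n)
        realGap≤tail n = nonNeg-resp
          (trans (solve 3 (λ a b c → a :- b := a :- c :- (b :- c)) refl _ _ _)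
            (+-congʳ (+-cong (convolution≈ (n ℕ.+ n)) (-‿cong (convolution≈ n)))))
          (S-convolution-≥ n 0≤term 0≤term)
          where
          0≤term : ∀ i → NonNeg (realTerm B i)
          0≤term i = ⊑⇒nonNeg (_⊴_.re-⊑ (z⊴ i))

        gap-⊴-tail : ∀ n → partialSum z n *ℂ partialSum w n +ℂ (-ℂ partialSum (z +ℂ w) n) ⊴ tail n + tail n
        gap-⊴-tail n = weaken (⊴-resp (ℂ′.+-congˡ {partialSum z n *ℂ partialSum w n} (ℂ′.-‿cong (complexConvolution≈ n)))
          (refl {realGap n + realGap n}) (gap-⊴ n z⊴ w⊴))
          where
          weaken : ∀ {u} → u ⊴ realGap n + realGap n → u ⊴ tail n + tail n
          weaken (p , q) = ⊑-weaken p ≤ , ⊑-weaken q ≤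
            where
            ≤ : NonNeg (tail n + tail n - (realGap n + realGap n))
            ≤ = nonNeg-resp (solve 2 (λ a b → (a :- b) :+ (a :- b) := a :+ a :- (b :+ b)) refl _ _)
              (+-nonNeg (realGap≤tail n) (realGap≤tail n))

        dominated : Nullℂ (λ n → partialSum z n *ℂ partialSum w n +ℂ (-ℂ partialSum (z +ℂ w) n))
        dominated = null-dominated (λ n → _⊴_.re-⊑ (gap-⊴-tail n)) tails , null-dominated (λ n → _⊴_.im-⊑ (gap-⊴-tail n)) tails
          where
          tails : Null (λ n → tail n + tail n)
          tails = null-+ (realTail-null (B + B)) (realTail-null (B + B))

    exp-+ : exp z *ℂ exp w ≈ℂ exp (z +ℂ w)
    exp-+ = limit-unique (limit-* (partialSum⟶exp z) (partialSum⟶exp w)) (partialSum⟶exp (z +ℂ w)) productGap-null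

-- The exponential on the imaginary axis

module Trigonometry {c ℓ₁ ℓ₂} (Real : RealNumbers c ℓ₁ ℓ₂)
  (exp : Complex.ℂ Real → Complex.ℂ Real) (isExponential : Complex.IsExponential Real exp) where
  open RealNumbers Real
  open Complex Real
  open ComplexRing Real
  open ComplexLimits Real
  open OrderedFieldProperties orderedField
  open IntegerCoefficients commutativeRing
  open ExponentialLaws Real exp isExponential
  private
    module ℂ′ where
      open CommutativeRing ℂ-ring public
      open IntegerCoefficients ℂ-ring public
    module Σℂ = FiniteSums ℂ-ring

  open RingProperties (CommutativeRing.ring commutativeRing) using (-0#≈0#)

  nullℂ-≈ : ∀ (u v : ℕ → ℂ) → (∀ n → u n ≈ℂ v n) → Nullℂ (λ n → u n +ℂ (-ℂ v n))
  nullℂ-≈ u v u≈v = nullℂ-resp {λ _ → 0ℂ} (λ n → ℂ′.sym (ℂ′.trans (ℂ′.+-congʳ { -ℂ v n} (u≈v n)) (ℂ′.-‿inverseʳ (v n))))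
    (null-0 , null-0)
    where
    null-0 : Null (λ _ → 0#)
    null-0 .eventually ε 0<ε = 0 , λ _ _ → ⊑-weaken (nonNeg⇒⊑ 0-nonNeg) (nonNeg-resp (solve 1 (λ e → e := e :- con (+ 0)) refl ε) (pos⇒nonNeg 0<ε))

  term-cong : ∀ {z w} → z ≈ℂ w → ∀ n → term z n ≈ℂ term w n
  term-cong {z} {w} z≈w n = *ℂ-cong {ofReal (recip (n !))} ℂ′.refl (power n)
    where
    power : ∀ n → z ^ℂ n ≈ℂ w ^ℂ n
    power zero    = ℂ′.refl
    power (suc n) = *ℂ-cong z≈w (power n)

  -- The function `exp` is any function with the prescribed limits, so respecting `_≈ℂ_` has to be
  -- proved: equivalent arguments have equivalent partial sums.
  exp-cong : ∀ {z w} → z ≈ℂ w → exp z ≈ℂ exp w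
  exp-cong {z} {w} z≈w = limit-unique (partialSum⟶exp z) (partialSum⟶exp w)
    (nullℂ-≈ (partialSum z) (partialSum w) (λ n → Σℂ.S-cong n (term-cong z≈w)))

  exp-0 : exp 0ℂ ≈ℂ 1ℂ
  -- Shifted by one, because the empty partial sum is 0 while all later ones are 1.
  exp-0 = limit-unique {partialSum 0ℂ ∘ suc} {λ _ → 1ℂ} shifted (nullℂ-≈ (λ _ → 1ℂ) (λ _ → 1ℂ) (λ _ → ℂ′.refl)) (nullℂ-≈ (partialSum 0ℂ ∘ suc) (λ _ → 1ℂ) constant)
    where
    shifted : (partialSum 0ℂ ∘ suc) ⟶₀ exp 0ℂ
    shifted = let (p , q) = partialSum⟶exp 0ℂ in
      null-subsequence suc ℕ.n≤1+n p , null-subsequence suc ℕ.n≤1+n q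

    vanish : ∀ n → term 0ℂ (suc n) ≈ℂ 0ℂ
    vanish n = ℂ′.trans (*ℂ-cong {ofReal (recip (suc n !))} ℂ′.refl (ℂ′.zeroˡ (0ℂ ^ℂ n))) (ℂ′.zeroʳ (ofReal (recip (suc n !))))

    constant : ∀ n → partialSum 0ℂ (suc n) ≈ℂ 1ℂ
    constant n = ℂ′.trans (Σℂ.S-shift n (term 0ℂ)) (ℂ′.trans
      (ℂ′.+-cong (Σℂ.initial (term-exponential 0ℂ)) (ℂ′.trans (Σℂ.S-cong n vanish) (Σℂ.S-zero n)))
      (ℂ′.+-identityʳ 1ℂ))

  conj : ℂ → ℂ
  conj z = re z +i (- im z)

  conj-+ : ∀ z w → conj (z +ℂ w) ≈ℂ conj z +ℂ conj w
  conj-+ z w = refl , solve 2 (λ b d → :- (b :+ d) := :- b :+ (:- d)) refl (im z) (im w)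

  conj-* : ∀ z w → conj (z *ℂ w) ≈ℂ conj z *ℂ conj w
  conj-* z w =
    solve 4 (λ a b c d → a :* c :- b :* d := a :* c :- (:- b) :* (:- d)) refl (re z) (im z) (re w) (im w) ,
    solve 4 (λ a b c d → :- (a :* d :+ b :* c) := a :* (:- d) :+ (:- b) :* c) refl (re z) (im z) (re w) (im w)

  conj-ofReal : ∀ x → conj (ofReal x) ≈ℂ ofReal x
  conj-ofReal x = refl , -0#≈0#

  conj-term : ∀ z n → conj (term z n) ≈ℂ term (conj z) n
  conj-term z n = ℂ′.trans (conj-* (ofReal (recip (n !))) (z ^ℂ n)) (*ℂ-cong (conj-ofReal (recip (n !))) (power n))
    where
    power : ∀ n → conj (z ^ℂ n) ≈ℂ conj z ^ℂ n
    power zero    = conj-ofReal 1#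
    power (suc n) = ℂ′.trans (conj-* z (z ^ℂ n)) (*ℂ-cong {conj z} ℂ′.refl (power n))

  conj-partialSum : ∀ z n → conj (partialSum z n) ≈ℂ partialSum (conj z) n
  conj-partialSum z zero    = conj-ofReal 0#
  conj-partialSum z (suc n) = ℂ′.trans (conj-+ (partialSum z n) (term z n)) (ℂ′.+-cong (conj-partialSum z n) (conj-term z n))

  exp-conj : ∀ z → exp (conj z) ≈ℂ conj (exp z)
  exp-conj z = limit-unique {u = partialSum (conj z)} {v = conj ∘ partialSum z} (partialSum⟶exp (conj z)) conjugated
    (nullℂ-≈ (partialSum (conj z)) (conj ∘ partialSum z) (λ n → ℂ′.sym {conj (partialSum z n)} {partialSum (conj z) n} (conj-partialSum z n)))
    where
    conjugated : (conj ∘ partialSum z) ⟶₀ conj (exp z)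
    conjugated = let (p , q) = partialSum⟶exp z in
      p , null-resp (λ n → solve 2 (λ a b → :- (a :- b) := (:- a) :- (:- b)) refl (im (partialSum z n)) (im (exp z))) (null-neg q)

  cis : Carrier → ℂ
  cis t = exp (0# +i t)

  cis-cong : ∀ {s t} → s ≈ t → cis s ≈ℂ cis t
  cis-cong s≈t = exp-cong (refl , s≈t)

  cis-0 : cis 0# ≈ℂ 1ℂ
  cis-0 = exp-0

  cis-+ : ∀ s t → cis s *ℂ cis t ≈ℂ cis (s + t)
  cis-+ s t = ℂ′.trans (exp-+ (0# +i s) (0# +i t)) (exp-cong (+-identityˡ 0# , refl))

  conj-cis : ∀ t → conj (cis t) ≈ℂ cis (- t)
  conj-cis t = ℂ′.sym (exp-conj (0# +i t))

  cis-*-conj : ∀ t → cis t *ℂ conj (cis t) ≈ℂ 1ℂ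
  cis-*-conj t = ℂ′.trans (*ℂ-cong {cis t} ℂ′.refl (conj-cis t))
    (ℂ′.trans (cis-+ t (- t)) (ℂ′.trans (cis-cong (-‿inverseʳ t)) cis-0))

  -- A real point of the unit circle squares to 1.
  im-cis≈0⇒cis[t+t]≈1 : ∀ {t} → im (cis t) ≈ 0# → cis (t + t) ≈ℂ 1ℂ
  im-cis≈0⇒cis[t+t]≈1 {t} im≈0 = ℂ′.trans (ℂ′.sym (cis-+ t t))
    (ℂ′.trans (*ℂ-cong {cis t} ℂ′.refl (refl , trans im≈0 (trans (sym -0#≈0#) (-‿cong (sym im≈0))))) (cis-*-conj t))

  -- 1 − e²ⁱᵗ = −2i eⁱᵗ sin t
  im-cis#0⇒1-cis[t+t]-invertible : ∀ {t} → im (cis t) # 0# →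
    ∃[ u ] (1ℂ +ℂ (-ℂ cis (t + t))) *ℂ u ≈ℂ 1ℂ
  im-cis#0⇒1-cis[t+t]-invertible {t} im#0 =
    -- With e = cis t, the conjugate inverts e, and conj e - e = -2i sin t has the inverse i x / 2,
    -- where x is the inverse of sin t.
    conj (cis t) *ℂ (0# +i (½ * x)) , (begin
      (1ℂ +ℂ (-ℂ cis (t + t))) *ℂ (conj e *ℂ h)
        ≈⟨ *ℂ-cong (ℂ′.+-cong (cis-*-conj t) (ℂ′.-‿cong (cis-+ t t))) (ℂ′.refl {conj e *ℂ h}) ⟨
      (e *ℂ conj e +ℂ (-ℂ (e *ℂ e))) *ℂ (conj e *ℂ h)
        ≈⟨ factor e (conj e) h ⟩
      (e *ℂ conj e) *ℂ ((conj e +ℂ (-ℂ e)) *ℂ h)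
        ≈⟨ *ℂ-cong (cis-*-conj t) imaginary ⟩
      1ℂ *ℂ 1ℂ
        ≈⟨ *ℂ-identityˡ 1ℂ ⟩
      1ℂ ∎)
    where
    open SetoidReasoning ℂ′.setoid
    e : ℂ
    e = cis t
    x : Carrier
    x = proj₁ (#⇒invertible im#0)
    h : ℂ
    h = 0# +i (½ * x)

    factor : ∀ e f h → (e *ℂ f +ℂ (-ℂ (e *ℂ e))) *ℂ (f *ℂ h) ≈ℂ (e *ℂ f) *ℂ ((f +ℂ (-ℂ e)) *ℂ h)
    factor = ℂ′.solve 3 (λ e f h → (e ℂ′.:* f ℂ′.:- e ℂ′.:* e) ℂ′.:* (f ℂ′.:* h) ℂ′.:= (e ℂ′.:* f) ℂ′.:* ((f ℂ′.:- e) ℂ′.:* h)) ℂ′.refl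

    inverse : (im e - 0#) * x ≈ 1#
    inverse = proj₂ (proj₂ (#⇒invertible im#0))

    real : ∀ a s y x → (a - a) * 0# - (- s - s) * (y * x) ≈ (y + y) * ((s - 0#) * x)
    real = solve 4 (λ a s y x → (a :- a) :* con (+ 0) :- (:- s :- s) :* (y :* x) := (y :+ y) :* ((s :- con (+ 0)) :* x)) refl

    imag : ∀ a s y → (a - a) * y + (- s - s) * 0# ≈ 0#
    imag = solve 3 (λ a s y → (a :- a) :* y :+ (:- s :- s) :* con (+ 0) := con (+ 0)) refl

    imaginary : (conj e +ℂ (-ℂ e)) *ℂ h ≈ℂ 1ℂ
    imaginary = trans (real (re e) (im e) ½ x) (trans (*-cong ½+½≈1 inverse) (*-identityˡ 1#)) ,
                imag (re e) (im e) (½ * x)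

-- The Möbius function and Ramanujan sums

unique-resp-↭ : {xs ys : List ℕ} → xs ↭ ys → Unique xs → Unique ys
unique-resp-↭ xs↭ys = PermutationProperties.Unique-resp-↭ (≡.setoid ℕ) (↭⇒↭ₛ xs↭ys)

-- The definition of `μ` uses the list chosen by `factorise`. Factorisations agree up to
-- permutation, so length and distinctness may be read off from any other one.
μ-unique : ∀ {n} (f : PrimeFactorisation n) .{{_ : NonZero n}} → Unique (factors f) →
  μ n ≡ -1ℤ ℤ.^ List.length (factors f)
μ-unique {n@(suc _)} f u = ≡.trans
  (≡.cong (λ b → if b then -1ℤ ℤ.^ List.length ps else 0ℤ) (dec-true (unique? ℕ._≟_ ps) (unique-resp-↭ (↭-sym ps↭fs) u)))
  (≡.cong (-1ℤ ℤ.^_) (↭-length ps↭fs))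
  where
  ps : List ℕ
  ps = factors (factorise n)
  ps↭fs : ps ↭ factors f
  ps↭fs = factorisationUnique (factorise n) f

μ-¬unique : ∀ {n} (f : PrimeFactorisation n) .{{_ : NonZero n}} → ¬ Unique (factors f) → μ n ≡ 0ℤ
μ-¬unique {n@(suc _)} f ¬u =
  ≡.cong (λ b → if b then -1ℤ ℤ.^ List.length ps else 0ℤ)
    (dec-false (unique? ℕ._≟_ ps) (¬u ∘ unique-resp-↭ (factorisationUnique (factorise n) f)))
  where
  ps : List ℕ
  ps = factors (factorise n)

factorisation-*-prime : ∀ {d p} → Prime p → PrimeFactorisation d → PrimeFactorisation (d ℕ.* p)
factorisation-*-prime {d} {p} pr f = record
  { factors         = p ∷ factors f
  ; isFactorisation = ≡.trans (ℕ.*-comm d p) (≡.cong (p ℕ.*_) (isFactorisation f))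
  ; factorsPrime    = pr ∷ factorsPrime f
  }

module _ {d p : ℕ} .{{_ : NonZero d}} .{{_ : NonZero (d ℕ.* p)}} (pr : Prime p) where
  private
    f : PrimeFactorisation d
    f = factorise d

  μ-*-prime-∣ : p ∣ d → μ (d ℕ.* p) ≡ 0ℤ
  μ-*-prime-∣ p∣d = μ-¬unique (factorisation-*-prime pr f) λ where
    (p∉ ∷ _) → All¬⇒¬Any p∉ (factorisationHasAllPrimeFactors pr (≡.subst (p ∣_) (isFactorisation f) p∣d) (factorsPrime f))

  -- A new prime in front keeps the factors distinct and changes the sign once. If they were not
  -- distinct before, both sides are 0.
  μ-*-prime-∤ : p ∤ d → μ (d ℕ.* p) ≡ ℤ.- μ d
  μ-*-prime-∤ p∤d = by-cases (unique? ℕ._≟_ (factors f))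
    where
    p∉ : p ∉ factors f
    p∉ p∈ = p∤d (≡.subst (p ∣_) (≡.sym (isFactorisation f)) (∈⇒∣product p∈))

    by-cases : Dec (Unique (factors f)) → μ (d ℕ.* p) ≡ ℤ.- μ d
    by-cases (yes u) = begin
      μ (d ℕ.* p)                                  ≡⟨ μ-unique (factorisation-*-prime pr f) (¬Any⇒All¬ _ p∉ ∷ u) ⟩
      -1ℤ ℤ.* -1ℤ ℤ.^ List.length (factors f)      ≡⟨ ℤ.-1*i≡-i _ ⟩
      ℤ.- (-1ℤ ℤ.^ List.length (factors f))        ≡⟨ ≡.cong ℤ.-_ (μ-unique f u) ⟨
      ℤ.- μ d                                      ∎
      where open ≡.≡-Reasoning
    by-cases (no ¬u) = ≡.trans (μ-¬unique (factorisation-*-prime pr f) (λ { (_ ∷ u) → ¬u u }))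
      (≡.cong ℤ.-_ (≡.sym (μ-¬unique f ¬u)))

primeDivisor : ∀ n .{{_ : NonZero n}} → n ≢ 1 → ∃[ p ] Prime p × p ∣ n
primeDivisor n n≢1 = first (factors f) (isFactorisation f) (factorsPrime f)
  where
  f : PrimeFactorisation n
  f = factorise n
  first : ∀ ps → n ≡ product ps → ListAll.All Prime ps → ∃[ p ] Prime p × p ∣ n
  first []       n≡1 _        = contradiction n≡1 n≢1
  first (p ∷ ps) n≡  (pr ∷ _) = p , pr , divides (product ps) (≡.trans n≡ (ℕ.*-comm p _))

-- Indicators and sums over divisors

module Indicators {c ℓ} (R : CommutativeRing c ℓ) where
  open CommutativeRing R
  open IntegerCoefficients R
  open FiniteSums R
  open SetoidReasoning setoid

  -- The argument is the decision, so matching on it computes the indicator; `[]-cong` passes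
  -- between decisions of equivalent propositions.
  [_] : ∀ {p} {P : Set p} → Dec P → Carrier
  [ yes _ ] = 1#
  [ no  _ ] = 0#

  []-true : ∀ {p} {P : Set p} (P? : Dec P) → P → [ P? ] ≈ 1#
  []-true (yes _) p = refl
  []-true (no ¬p) p = contradiction p ¬p

  []-false : ∀ {p} {P : Set p} (P? : Dec P) → ¬ P → [ P? ] ≈ 0#
  []-false (yes p) ¬p = contradiction p ¬p
  []-false (no _)  ¬p = refl

  []-cong : ∀ {p q} {P : Set p} {Q : Set q} (P? : Dec P) (Q? : Dec Q) → (P → Q) → (Q → P) → [ P? ] ≈ [ Q? ]
  []-cong (yes p) Q? f g = sym ([]-true Q? (f p))
  []-cong (no ¬p) Q? f g = sym ([]-false Q? (¬p ∘ g))

  []-× : ∀ {p q r} {P : Set p} {Q : Set q} {R : Set r} (P? : Dec P) (Q? : Dec Q) (R? : Dec R) →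
    (P → Q → R) → (R → P) → (R → Q) → [ P? ] * [ Q? ] ≈ [ R? ]
  []-× (yes p) Q? R? f g h = trans (*-identityˡ _) ([]-cong Q? R? (f p) h)
  []-× (no ¬p) Q? R? f g h = trans (zeroˡ _) (sym ([]-false R? (¬p ∘ g)))

  -- Starting at 1 lets `T-cong` supply `NonZero` instances for the index.
  T : ℕ → (ℕ → Carrier) → Carrier
  T n f = S n (f ∘ suc)

  T-cong : ∀ n {f g : ℕ → Carrier} → (∀ i .{{_ : NonZero i}} → f i ≈ g i) → T n f ≈ T n g
  T-cong n f≈g = S-cong n (λ i → f≈g (suc i))

  S-split : ∀ m n f → S (m ℕ.+ n) f ≈ S m f + S n (f ∘ (m ℕ.+_))
  S-split m zero    f = trans (reflexive (≡.cong (λ k → S k f) (ℕ.+-identityʳ m))) (sym (+-identityʳ _))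
  S-split m (suc n) f = trans (reflexive (≡.cong (λ k → S k f) (ℕ.+-suc m n)))
    (trans (+-congʳ (S-split m n f)) (+-assoc _ _ _))

  S-vanish : ∀ n {f} → (∀ i → i ℕ.< n → f i ≈ 0#) → S n f ≈ 0#
  S-vanish n f≈0 = trans (S-cong< n f≈0) (S-zero n)

  T-truncate : ∀ {m n} {f : ℕ → Carrier} → m ℕ.≤ n → (∀ i → m ℕ.< i → f i ≈ 0#) → T n f ≈ T m f
  T-truncate {m} {n} {f} m≤n f≈0 = begin
    T n f                                             ≡⟨ ≡.cong (λ k → T k f) (ℕ.m+[n∸m]≡n m≤n) ⟨
    T (m ℕ.+ (n ℕ.∸ m)) f                             ≈⟨ S-split m (n ℕ.∸ m) (f ∘ suc) ⟩
    T m f + S (n ℕ.∸ m) (λ i → f (suc (m ℕ.+ i)))     ≈⟨ +-congˡ (S-vanish (n ℕ.∸ m) (λ i _ → f≈0 _ (ℕ.s≤s (ℕ.m≤m+n m i)))) ⟩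
    T m f + 0#                                        ≈⟨ +-identityʳ _ ⟩
    T m f                                             ∎

  T-pick : ∀ n a (f : ℕ → Carrier) .{{_ : NonZero a}} → a ℕ.≤ n → T n (λ i → [ i ℕ.≟ a ] * f i) ≈ f a
  T-pick n a@(suc b) f a≤n = begin
    T n (λ i → [ i ℕ.≟ a ] * f i)
      ≈⟨ T-truncate a≤n (λ i a<i → miss i (ℕ.>⇒≢ a<i)) ⟩
    S b (λ i → [ suc i ℕ.≟ a ] * f (suc i)) + [ a ℕ.≟ a ] * f a
      ≈⟨ +-cong (S-vanish b (λ i i<b → miss (suc i) (λ i≡b → ℕ.<⇒≢ i<b (ℕ.suc-injective i≡b))))
                (*-congʳ ([]-true (a ℕ.≟ a) ≡.refl)) ⟩
    0# + 1# * f a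
      ≈⟨ trans (+-identityˡ _) (*-identityˡ _) ⟩
    f a ∎
    where
    miss : ∀ i → i ≢ a → [ i ℕ.≟ a ] * f i ≈ 0#
    miss i i≢a = trans (*-congʳ ([]-false (i ℕ.≟ a) i≢a)) (zeroˡ _)

  -- Induction over blocks of b consecutive numbers: in each block only the last one is a multiple
  -- of b.
  T-multiples : ∀ a b (f : ℕ → Carrier) .{{_ : NonZero b}} → T (a ℕ.* b) (λ i → [ b ∣? i ] * f i) ≈ T a (λ i → f (i ℕ.* b))
  T-multiples zero    b f = refl
  T-multiples (suc a) b@(suc b′) f = begin
    T (b ℕ.+ a ℕ.* b) g
      ≡⟨ ≡.cong (λ k → T k g) (ℕ.+-comm b (a ℕ.* b)) ⟩
    T (a ℕ.* b ℕ.+ b) g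
      ≈⟨ S-split (a ℕ.* b) b (g ∘ suc) ⟩
    T (a ℕ.* b) g + (S b′ (λ i → g (suc (a ℕ.* b ℕ.+ i))) + g (suc (a ℕ.* b ℕ.+ b′)))
      ≈⟨ +-cong (T-multiples a b f) (+-cong (S-vanish b′ miss) hit) ⟩
    T a (λ i → f (i ℕ.* b)) + (0# + f (suc a ℕ.* b))
      ≈⟨ +-congˡ (+-identityˡ _) ⟩
    T a (λ i → f (i ℕ.* b)) + f (suc a ℕ.* b) ∎
    where
    g : ℕ → Carrier
    g i = [ b ∣? i ] * f i

    miss : ∀ i → i ℕ.< b′ → g (suc (a ℕ.* b ℕ.+ i)) ≈ 0#
    miss i i<b′ = trans (*-congʳ ([]-false (b ∣? _) b∤)) (zeroˡ _)
      where
      b∤ : b ∤ suc (a ℕ.* b ℕ.+ i)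
      b∤ b∣ = >⇒∤ (ℕ.s<s i<b′) (∣m+n∣m⇒∣n (≡.subst (b ∣_) (≡.sym (ℕ.+-suc (a ℕ.* b) i)) b∣) (n∣m*n a))

    hit : g (suc (a ℕ.* b ℕ.+ b′)) ≈ f (suc a ℕ.* b)
    hit = trans (reflexive (≡.cong g (≡.trans (≡.sym (ℕ.+-suc (a ℕ.* b) b′)) (ℕ.+-comm (a ℕ.* b) b))))
      (trans (*-congʳ ([]-true (b ∣? _) (n∣m*n (suc a)))) (*-identityˡ _))

  module _ {a} {A : Set a} where
    sumOver-cong : ∀ (xs : List A) {f g} → (∀ x → f x ≈ g x) → sumOver xs f ≈ sumOver xs g
    sumOver-cong []       f≈g = refl
    sumOver-cong (x ∷ xs) f≈g = +-cong (f≈g x) (sumOver-cong xs f≈g)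

    sumOver-*ˡ : ∀ (xs : List A) y f → sumOver xs (λ x → y * f x) ≈ y * sumOver xs f
    sumOver-*ˡ []       y f = sym (zeroʳ y)
    sumOver-*ˡ (x ∷ xs) y f = trans (+-congˡ (sumOver-*ˡ xs y f)) (sym (distribˡ y _ _))

    S-sumOver-swap : ∀ n (xs : List A) (f : ℕ → A → Carrier) →
      S n (λ i → sumOver xs (f i)) ≈ sumOver xs (λ x → S n (λ i → f i x))
    S-sumOver-swap n []       f = S-zero n
    S-sumOver-swap n (x ∷ xs) f = trans (S-+ n _ _) (+-congˡ (S-sumOver-swap n xs f))

    sumOver-++ : ∀ (xs ys : List A) f → sumOver (xs List.++ ys) f ≈ sumOver xs f + sumOver ys f
    sumOver-++ []       ys f = sym (+-identityˡ _)
    sumOver-++ (x ∷ xs) ys f = trans (+-congˡ (sumOver-++ xs ys f)) (sym (+-assoc _ _ _))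

    sumOver-filter : ∀ {p} {P : A → Set p} (P? : Decidable P) xs f →
      sumOver (List.filter P? xs) f ≈ sumOver xs (λ x → [ P? x ] * f x)
    sumOver-filter P? []       f = refl
    sumOver-filter P? (x ∷ xs) f with P? x
    ... | yes _ = +-cong (sym (*-identityˡ _)) (sumOver-filter P? xs f)
    ... | no  _ = trans (sumOver-filter P? xs f) (sym (trans (+-congʳ (zeroˡ _)) (+-identityˡ _)))

  sumOver-map : ∀ {a b} {A : Set a} {B : Set b} (h : A → B) xs f → sumOver (List.map h xs) f ≈ sumOver xs (f ∘ h)
  sumOver-map h []       f = refl
  sumOver-map h (x ∷ xs) f = +-congˡ (sumOver-map h xs f)

  sumOver-cartesianProductWith : ∀ {a b d} {A : Set a} {B : Set b} {D : Set d} (h : A → B → D) xs ys f →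
    sumOver (List.cartesianProductWith h xs ys) f ≈ sumOver xs (λ x → sumOver ys (λ y → f (h x y)))
  sumOver-cartesianProductWith h []       ys f = refl
  sumOver-cartesianProductWith h (x ∷ xs) ys f = trans (sumOver-++ (List.map (h x) ys) _ f)
    (+-cong (sumOver-map (h x) ys f) (sumOver-cartesianProductWith h xs ys f))

  sumOver-mapMaybe : ∀ {a b} {A : Set a} {B : Set b} (h : A → Maybe B) xs f →
    sumOver (List.mapMaybe h xs) f ≈ sumOver xs (λ x → maybe′ f 0# (h x))
  sumOver-mapMaybe h []       f = refl
  sumOver-mapMaybe h (x ∷ xs) f with h x
  ... | just _  = +-congˡ (sumOver-mapMaybe h xs f)
  ... | nothing = trans (sumOver-mapMaybe h xs f) (sym (+-identityˡ _))

  -- e = n / d is singled out by the indicator of e d = n.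
  sumOver-divisors : ∀ n .{{_ : NonZero n}} (f : ℕ → ℕ → Carrier) →
    sumOver (divisors n) (λ (d , d∣n) → f d (quotient d∣n)) ≈ T n (λ d → T n (λ e → [ e ℕ.* d ℕ.≟ n ] * f d e))
  sumOver-divisors n f = begin
    sumOver (divisors n) g
      ≈⟨ sumOver-mapMaybe (λ d → Maybe.map (d ,_) (dec⇒maybe (d ∣? n))) [1⋯ n ] g ⟩
    sumOver [1⋯ n ] (λ d → maybe′ g 0# (Maybe.map (d ,_) (dec⇒maybe (d ∣? n))))
      ≈⟨ sumOver-applyUpTo suc n _ ⟩
    T n (λ d → maybe′ g 0# (Maybe.map (d ,_) (dec⇒maybe (d ∣? n))))
      ≈⟨ T-cong n (λ d → inner d (d ∣? n)) ⟩
    T n (λ d → T n (λ e → [ e ℕ.* d ℕ.≟ n ] * f d e)) ∎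
    where
    g : Divisor n → Carrier
    g (d , d∣n) = f d (quotient d∣n)

    inner : ∀ d .{{_ : NonZero d}} (d∣n? : Dec (d ∣ n)) →
      maybe′ g 0# (Maybe.map (d ,_) (dec⇒maybe d∣n?)) ≈ T n (λ e → [ e ℕ.* d ℕ.≟ n ] * f d e)
    inner d (no d∤n)   = sym (S-vanish n (λ i _ → trans
      (*-congʳ ([]-false (suc i ℕ.* d ℕ.≟ n) (λ eq → d∤n (divides (suc i) (≡.sym eq))))) (zeroˡ _)))
    inner d (yes d∣n) = sym (begin
      T n (λ e → [ e ℕ.* d ℕ.≟ n ] * f d e)
        ≈⟨ T-cong n (λ e → *-congʳ {f d e} ([]-cong (e ℕ.* d ℕ.≟ n) (e ℕ.≟ quotient d∣n)
             (λ eq → ℕ.*-cancelʳ-≡ e (quotient d∣n) d (≡.trans eq (_∣_.equality d∣n)))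
             (λ { ≡.refl → ≡.sym (_∣_.equality d∣n) }))) ⟩
      T n (λ e → [ e ℕ.≟ quotient d∣n ] * f d e)
        ≈⟨ T-pick n (quotient d∣n) (f d) {{quotient≢0 d∣n}} (∣⇒≤ (quotient-∣ d∣n)) ⟩
      f d (quotient d∣n) ∎)

-- The divisor sum of the Möbius function

module MöbiusSum {c ℓ} (R : CommutativeRing c ℓ) where
  open CommutativeRing R
  open IntegerCoefficients R
  open FiniteSums R
  open Indicators R
  open SetoidReasoning setoid

  mob : ℕ → Carrier
  mob n = ι (μ n)

  private
    -- The divisors of a p prime to p are those of a, and the others are p d with d ∣ a.
    cancelling : ∀ a p .{{_ : NonZero a}} → Prime p → T (a ℕ.* p) (λ d → [ d ∣? a ℕ.* p ] * mob d) ≈ 0#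
    cancelling a p pr = begin
      T n (λ d → [ d ∣? n ] * mob d)
        ≈⟨ T-cong n (λ d → solve 2 (λ i x → x := i :* x :+ (con (+ 1) :- i) :* x) refl [ p ∣? d ] ([ d ∣? n ] * mob d)) ⟩
      T n (λ d → [ p ∣? d ] * ([ d ∣? n ] * mob d) + (1# - [ p ∣? d ]) * ([ d ∣? n ] * mob d))
        ≈⟨ S-+ n _ _ ⟩
      T n (λ d → [ p ∣? d ] * ([ d ∣? n ] * mob d)) + T n (λ d → (1# - [ p ∣? d ]) * ([ d ∣? n ] * mob d))
        -- The multiples of p are reindexed as d p with d ≤ a. For the others the condition becomes
        -- d ∣ a, which fails beyond a, so that sum is cut there.
        ≈⟨ +-cong (trans (T-multiples a p (λ d → [ d ∣? n ] * mob d)) (T-cong a multiple))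
                  (trans (T-cong n (λ d → coprime d (p ∣? d))) (T-truncate (ℕ.m≤m*n a p) beyond)) ⟩
      T a (λ d → - 1# * term d) + T a term
        ≈⟨ +-congʳ (S-*ˡ a (- 1#) (term ∘ suc)) ⟩
      - 1# * T a term + T a term
        ≈⟨ solve 1 (λ x → con -[1+ 0 ] :* x :+ x := con (+ 0)) refl (T a term) ⟩
      0# ∎
      where
      n : ℕ
      n = a ℕ.* p
      instance
        p≢0 : NonZero p
        p≢0 = prime⇒nonZero pr

      -- Since μ(d p) is - μ(d) or 0 according to whether p ∤ d, both halves reduce to this summand,
      -- with opposite signs.
      term : ℕ → Carrier
      term d = (1# - [ p ∣? d ]) * ([ d ∣? a ] * mob d)

      mob-multiple : ∀ d .{{_ : NonZero d}} (p∣d? : Dec (p ∣ d)) → mob (d ℕ.* p) ≈ - 1# * ((1# - [ p∣d? ]) * mob d)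
      mob-multiple d (yes p∣d) = trans (reflexive (≡.cong ι (μ-*-prime-∣ {{it}} {{ℕ.m*n≢0 d p}} pr p∣d)))
        (solve 1 (λ x → con (+ 0) := con -[1+ 0 ] :* ((con (+ 1) :- con (+ 1)) :* x)) refl (mob d))
      mob-multiple d (no p∤d) = trans (reflexive (≡.cong ι (μ-*-prime-∤ {{it}} {{ℕ.m*n≢0 d p}} pr p∤d)))
        (trans (ι-neg (μ d)) (solve 1 (λ x → :- x := con -[1+ 0 ] :* ((con (+ 1) :- con (+ 0)) :* x)) refl (mob d)))

      multiple : ∀ d .{{_ : NonZero d}} → [ d ℕ.* p ∣? n ] * mob (d ℕ.* p) ≈ - 1# * term d
      multiple d = trans
        (*-cong ([]-cong (d ℕ.* p ∣? n) (d ∣? a) (*-cancelʳ-∣ p) (*-monoˡ-∣ p)) (mob-multiple d (p ∣? d)))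
        (solve 3 (λ i j x → i :* (con -[1+ 0 ] :* (j :* x)) := con -[1+ 0 ] :* (j :* (i :* x))) refl _ _ _)

      coprime : ∀ d .{{_ : NonZero d}} (p∣d? : Dec (p ∣ d)) →
        (1# - [ p∣d? ]) * ([ d ∣? n ] * mob d) ≈ (1# - [ p∣d? ]) * ([ d ∣? a ] * mob d)
      coprime d (yes _)   = solve 2 (λ x y → (con (+ 1) :- con (+ 1)) :* x := (con (+ 1) :- con (+ 1)) :* y) refl _ _
      coprime d (no p∤d) = *-congˡ (*-congʳ ([]-cong (d ∣? n) (d ∣? a) to (∣m⇒∣m*n p)))
        where
        to : d ∣ n → d ∣ a
        -- From a p = q d and p ∤ d, Euclid's lemma gives p ∣ q; cancelling p exhibits a as a
        -- multiple of d.
        to (divides q ap≡qd) = [ (λ p∣q → divides (quotient p∣q) (ℕ.*-cancelʳ-≡ a _ p (≡.trans ap≡qd (rearrange p∣q)))) ,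
          (λ p∣d → contradiction p∣d p∤d) ]′ (euclidsLemma q d pr (divides a (≡.sym ap≡qd)))
          where
          rearrange : (p∣q : p ∣ q) → q ℕ.* d ≡ quotient p∣q ℕ.* d ℕ.* p
          rearrange (divides r ≡.refl) = ≡.trans (ℕ.*-assoc r p d)
            (≡.trans (≡.cong (r ℕ.*_) (ℕ.*-comm p d)) (≡.sym (ℕ.*-assoc r d p)))

      beyond : ∀ d → a ℕ.< d → term d ≈ 0#
      beyond d a<d = trans (*-congˡ (trans (*-congʳ ([]-false (d ∣? a) (>⇒∤ a<d))) (zeroˡ _))) (zeroʳ _)

  -- For n other than 1 a single prime divisor p suffices: `cancelling` at n = a p also covers the
  -- case p ∣ a.
  sum-mob : ∀ n .{{_ : NonZero n}} → T n (λ d → [ d ∣? n ] * mob d) ≈ [ n ℕ.≟ 1 ]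
  sum-mob n = by-cases (n ℕ.≟ 1)
    where
    by-cases : (n≟1 : Dec (n ≡ 1)) → T n (λ d → [ d ∣? n ] * mob d) ≈ [ n≟1 ]
    by-cases (yes ≡.refl) = trans (+-identityˡ _) (*-identityˡ _)
    by-cases (no n≢1) = let (p , pr , divides a n≡ap) = primeDivisor n n≢1 in composite a p pr n≡ap
      where
      composite : ∀ a p → Prime p → n ≡ a ℕ.* p → T n (λ d → [ d ∣? n ] * mob d) ≈ 0#
      composite a p pr n≡ap = trans
        (reflexive (≡.cong (λ n → T n (λ d → [ d ∣? n ] * mob d)) n≡ap))
        (cancelling a p {{ℕ.m*n≢0⇒m≢0 a {{≡.subst NonZero n≡ap (ℕ.≢-nonZero (ℕ.≢-nonZero⁻¹ n))}}}} pr)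

  coprime-indicator : ∀ n j .{{_ : NonZero n}} →
    [ gcd j n ℕ.≟ 1 ] ≈ T n (λ d → [ d ∣? n ] * ([ d ∣? j ] * mob d))
  coprime-indicator n j = sym (begin
    T n (λ d → [ d ∣? n ] * ([ d ∣? j ] * mob d))
      ≈⟨ T-cong n (λ d → trans (sym (*-assoc _ _ (mob d))) (*-congʳ {mob d}
           ([]-× (d ∣? n) (d ∣? j) (d ∣? g) (λ d∣n d∣j → gcd-greatest d∣j d∣n)
             (λ d∣g → ∣-trans d∣g (gcd[m,n]∣n j n)) (λ d∣g → ∣-trans d∣g (gcd[m,n]∣m j n))))) ⟩
    T n (λ d → [ d ∣? g ] * mob d)
      ≈⟨ T-truncate (∣⇒≤ (gcd[m,n]∣n j n)) (λ d g<d → trans (*-congʳ {mob d} ([]-false (d ∣? g) (>⇒∤ g<d))) (zeroˡ _)) ⟩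
    T g (λ d → [ d ∣? g ] * mob d)
      ≈⟨ sum-mob g ⟩
    [ g ℕ.≟ 1 ] ∎)
    where
    g : ℕ
    g = gcd j n
    instance
      g≢0 : NonZero g
      g≢0 = ℕ.≢-nonZero (gcd[m,n]≢0 j n (inj₂ (ℕ.≢-nonZero⁻¹ n)))

-- Orthogonality and the divisor formula for Ramanujan sums

module RootsOfUnity {c ℓ} (R : CommutativeRing c ℓ) where
  open CommutativeRing R
  open IntegerCoefficients R
  open FiniteSums R
  open Indicators R
  open MöbiusSum R
  open Mult semiring using (×1-homo-*)
  open SetoidReasoning setoid

  -- w n a stands for exp (2πi a / n).
  record IsRootSystem (w : ℕ → ℕ → Carrier) : Set (c ⊔ ℓ) where
    field
      w-0       : ∀ n → w n 0 ≈ 1#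
      w-+       : ∀ n a b → w n (a ℕ.+ b) ≈ w n a * w n b
      w-full    : ∀ n .{{_ : NonZero n}} → w n n ≈ 1#
      w-scale   : ∀ n d a .{{_ : NonZero n}} .{{_ : NonZero d}} → w (n ℕ.* d) (a ℕ.* d) ≈ w n a
      w-reduced : ∀ n a .{{_ : NonZero a}} → a ℕ.< n → ∃[ u ] (1# - w n a) * u ≈ 1#

  S-telescope : ∀ n (f : ℕ → Carrier) → S n (λ i → f i - f (suc i)) ≈ f 0 - f n
  S-telescope zero    f = sym (-‿inverseʳ _)
  S-telescope (suc n) f = trans (+-congʳ (S-telescope n f))
    (solve 3 (λ a b c → a :- b :+ (b :- c) := a :- c) refl (f 0) (f n) (f (suc n)))

  S-one : ∀ n → S n (λ _ → 1#) ≈ n · 1#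
  S-one zero    = refl
  S-one (suc n) = trans (+-comm _ _) (+-congˡ (S-one n))

  T-count : ∀ {M L} .{{_ : NonZero L}} (L∣M : L ∣ M) → T M (λ k → [ L ∣? k ]) ≈ quotient L∣M · 1#
  T-count {L = L} (divides q ≡.refl) = begin
    T (q ℕ.* L) (λ k → [ L ∣? k ])        ≈⟨ T-cong (q ℕ.* L) (λ k → *-identityʳ [ L ∣? k ]) ⟨
    T (q ℕ.* L) (λ k → [ L ∣? k ] * 1#)   ≈⟨ T-multiples q L (λ _ → 1#) ⟩
    T q (λ _ → 1#)                        ≈⟨ S-one q ⟩
    q · 1#                                ∎

  module RamanujanSum {w} (isRootSystem : IsRootSystem w) where
    open IsRootSystem isRootSystem

    w-multiple : ∀ n q .{{_ : NonZero n}} → w n (q ℕ.* n) ≈ 1#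
    w-multiple n zero    = w-0 n
    w-multiple n (suc q) = trans (w-+ n n (q ℕ.* n)) (trans (*-cong (w-full n) (w-multiple n q)) (*-identityˡ 1#))

    -- Whole turns contribute the factor 1, so k may be replaced by its remainder, which is positive
    -- because n ∤ k.
    w-separated : ∀ n k .{{_ : NonZero n}} → n ∤ k → ∃[ u ] (1# - w n k) * u ≈ 1#
    w-separated n k n∤k = let (u , eq) = w-reduced n (k % n) {{ℕ.≢-nonZero r≢0}} (m%n<n k n) in
      u , trans (*-congʳ (+-congˡ (-‿cong w≈))) eq
      where
      r≢0 : k % n ≢ 0
      r≢0 r≡0 = n∤k (m%n≡0⇒n∣m k n r≡0)
      w≈ : w n k ≈ w n (k % n)
      w≈ = begin
        w n k                                 ≡⟨ ≡.cong (w n) (m≡m%n+[m/n]*n k n) ⟩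
        w n (k % n ℕ.+ k / n ℕ.* n)           ≈⟨ w-+ n _ _ ⟩
        w n (k % n) * w n (k / n ℕ.* n)       ≈⟨ *-congˡ (w-multiple n (k / n)) ⟩
        w n (k % n) * 1#                      ≈⟨ *-identityʳ _ ⟩
        w n (k % n)                           ∎

    -- For n ∤ k, multiplying the geometric sum by 1 - w n k telescopes it to w n k - w n (k + n k)
    -- = 0, and the invertible factor is removed.
    orthogonality : ∀ n k .{{_ : NonZero n}} → T n (λ j → w n (j ℕ.* k)) ≈ [ n ∣? k ] * (n · 1#)
    orthogonality n k = by-cases (n ∣? k)
      where
      f : ℕ → Carrier
      f i = w n (suc i ℕ.* k)

      by-cases : (n∣k? : Dec (n ∣ k)) → T n (λ j → w n (j ℕ.* k)) ≈ [ n∣k? ] * (n · 1#)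
      by-cases (yes (divides q ≡.refl)) = trans
        (T-cong n (λ j → trans (reflexive (≡.cong (w n) (≡.sym (ℕ.*-assoc j q n)))) (w-multiple n (j ℕ.* q))))
        (trans (S-one n) (sym (*-identityˡ _)))
      by-cases (no n∤k) = let (u , eq) = w-separated n k n∤k in begin
        S n f                                   ≈⟨ *-identityʳ _ ⟨
        S n f * 1#                              ≈⟨ *-congˡ eq ⟨
        S n f * ((1# - w n k) * u)              ≈⟨ solve 3 (λ s z u → s :* (z :* u) := (z :* s) :* u) refl (S n f) (1# - w n k) u ⟩
        ((1# - w n k) * S n f) * u              ≈⟨ *-congʳ (S-*ˡ n (1# - w n k) f) ⟨
        S n (λ i → (1# - w n k) * f i) * u      ≈⟨ *-congʳ (S-cong n (λ i → trans
                                                     (solve 2 (λ z x → (con (+ 1) :- z) :* x := x :- z :* x) refl (w n k) (f i))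
                                                     (+-congˡ (-‿cong (sym (w-+ n k (suc i ℕ.* k))))))) ⟩
        S n (λ i → f i - f (suc i)) * u         ≈⟨ *-congʳ (S-telescope n f) ⟩
        -- By computation `f 0` is `w n (k ℕ.+ 0)` and `f n` is `w n (k ℕ.+ n ℕ.* k)`; the latter
        -- adds k whole turns.
        (f 0 - f n) * u                         ≈⟨ *-congʳ (+-congˡ (-‿cong (trans (w-+ n k (n ℕ.* k)) (*-cong
                                                     (reflexive (≡.cong (w n) (≡.sym (ℕ.+-identityʳ k))))
                                                     (trans (reflexive (≡.cong (w n) (ℕ.*-comm n k))) (w-multiple n k)))))) ⟩
        (f 0 - f 0 * 1#) * u                    ≈⟨ solve 2 (λ x u → (x :- x :* con (+ 1)) :* u := con (+ 0)) refl (f 0) u ⟩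
        0#                                      ≈⟨ zeroˡ _ ⟨
        0# * (n · 1#)                           ∎

    -- For w n a = `cis (angle n a)` this unfolds to the Ramanujan sum of the theorem, so
    -- `E-formula` applies to `E` directly.
    ramanujanSum : ℕ → ℕ → Carrier
    ramanujanSum n k = sumOver (List.filter (λ j → gcd j n ℕ.≟ 1) [1⋯ n ]) (λ j → w n (j ℕ.* k))

    -- Expanding coprimality by Möbius leaves, for e ∣ n with n = q e, a sum over j = e i. Scaling
    -- turns w n (e i k) into w q (i k), and orthogonality modulo q gives q [q ∣ k]. Thus e is the
    -- cofactor and q the divisor d of the formula.
    ramanujanSum-divisors : ∀ n k .{{_ : NonZero n}} →
      ramanujanSum n k ≈ sumOver (divisors n) (λ (d , d∣n) → [ d ∣? k ] * ((d · 1#) * mob (quotient d∣n)))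
    ramanujanSum-divisors n k = begin
      ramanujanSum n k
        ≈⟨ sumOver-filter (λ j → gcd j n ℕ.≟ 1) [1⋯ n ] _ ⟩
      sumOver [1⋯ n ] (λ j → [ gcd j n ℕ.≟ 1 ] * w n (j ℕ.* k))
        ≈⟨ sumOver-applyUpTo suc n _ ⟩
      T n (λ j → [ gcd j n ℕ.≟ 1 ] * w n (j ℕ.* k))
        ≈⟨ T-cong n (λ j → trans (*-congʳ {w n (j ℕ.* k)} (coprime-indicator n j)) (sym (S-*ʳ n (w n (j ℕ.* k)) _))) ⟩
      T n (λ j → T n (λ e → [ e ∣? n ] * ([ e ∣? j ] * mob e) * w n (j ℕ.* k)))
        ≈⟨ S-swap n n _ ⟩
      T n (λ e → T n (λ j → [ e ∣? n ] * ([ e ∣? j ] * mob e) * w n (j ℕ.* k)))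
        ≈⟨ T-cong n (λ e → trans
             (T-cong n (λ j → solve 4 (λ a b c d → a :* (b :* c) :* d := a :* c :* (b :* d)) refl [ e ∣? n ] [ e ∣? j ] (mob e) (w n (j ℕ.* k))))
             (S-*ˡ n ([ e ∣? n ] * mob e) _)) ⟩
      T n (λ e → [ e ∣? n ] * mob e * T n (λ j → [ e ∣? j ] * w n (j ℕ.* k)))
        ≈⟨ T-cong n (λ e → by-cofactor e (e ∣? n)) ⟩
      T n (λ e → T n (λ d → [ e ℕ.* d ℕ.≟ n ] * term d e))
        ≈⟨ S-swap n n _ ⟩
      T n (λ d → T n (λ e → [ e ℕ.* d ℕ.≟ n ] * term d e))
        ≈⟨ sumOver-divisors n term ⟨
      sumOver (divisors n) (λ (d , d∣n) → term d (quotient d∣n)) ∎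
      where
      term : ℕ → ℕ → Carrier
      term d e = [ d ∣? k ] * ((d · 1#) * mob e)

      by-cofactor : ∀ e .{{_ : NonZero e}} (e∣n? : Dec (e ∣ n)) →
        [ e∣n? ] * mob e * T n (λ j → [ e ∣? j ] * w n (j ℕ.* k)) ≈ T n (λ d → [ e ℕ.* d ℕ.≟ n ] * term d e)
      by-cofactor e (no e∤n) = trans (*-congʳ (zeroˡ (mob e))) (trans (zeroˡ _) (sym (S-vanish n (λ i _ → trans
        (*-congʳ ([]-false (e ℕ.* suc i ℕ.≟ n) (λ eq → e∤n (divides (suc i) (≡.trans (≡.sym eq) (ℕ.*-comm e (suc i))))))) (zeroˡ _)))))
      by-cofactor e (yes e∣n@(divides q n≡qe)) = begin
        1# * mob e * T n (λ j → [ e ∣? j ] * w n (j ℕ.* k))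
          ≡⟨ ≡.cong (λ n → 1# * mob e * T n (λ j → [ e ∣? j ] * w n (j ℕ.* k))) n≡qe ⟩
        1# * mob e * T (q ℕ.* e) (λ j → [ e ∣? j ] * w (q ℕ.* e) (j ℕ.* k))
          ≈⟨ *-congˡ (T-multiples q e (λ j → w (q ℕ.* e) (j ℕ.* k))) ⟩
        1# * mob e * T q (λ j → w (q ℕ.* e) (j ℕ.* e ℕ.* k))
          ≈⟨ *-congˡ (T-cong q (λ j → trans (reflexive (≡.cong (w (q ℕ.* e)) (rearrange j))) (w-scale q e (j ℕ.* k)))) ⟩
        1# * mob e * T q (λ j → w q (j ℕ.* k))
          ≈⟨ *-congˡ (orthogonality q k) ⟩
        1# * mob e * ([ q ∣? k ] * (q · 1#))
          ≈⟨ solve 3 (λ m i q → con (+ 1) :* m :* (i :* q) := i :* (q :* m)) refl (mob e) [ q ∣? k ] (q · 1#) ⟩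
        term q e
          -- The single value is spread over all d with an indicator, to match `sumOver-divisors`
          -- after the sums are exchanged.
          ≈⟨ T-pick n q (λ d → term d e) (∣⇒≤ (quotient-∣ e∣n)) ⟨
        T n (λ d → [ d ℕ.≟ q ] * term d e)
          ≈⟨ T-cong n (λ d → *-congʳ {term d e} ([]-cong (d ℕ.≟ q) (e ℕ.* d ℕ.≟ n)
               (λ { ≡.refl → ≡.trans (ℕ.*-comm e d) (≡.sym n≡qe) })
               (λ eq → ℕ.*-cancelʳ-≡ d q e (≡.trans (ℕ.*-comm d e) (≡.trans eq n≡qe))))) ⟩
        T n (λ d → [ e ℕ.* d ℕ.≟ n ] * term d e) ∎
        where
        instance
          q≢0 : NonZero q
          q≢0 = quotient≢0 e∣n
        rearrange : ∀ j → j ℕ.* e ℕ.* k ≡ j ℕ.* k ℕ.* e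
        rearrange j = ≡.trans (ℕ.*-assoc j e k) (≡.trans (≡.cong (j ℕ.*_) (ℕ.*-comm e k)) (≡.sym (ℕ.*-assoc j k e)))

    weight : ∀ {r} {m : Vec ℕ r} → All Divisor m → Carrier
    weight d = (productᵛ (entries d) · 1#) * ι (productᵛℤ (Vec.map μ (cofactors d)))

    productOver : ∀ {r} → Vec ℕ r → (ℕ → Carrier) → Carrier
    productOver m f = Vec.foldr′ (λ x p → f x * p) 1# m

    product-ramanujanSum : ∀ {r} (m : Vec ℕ r) → All NonZero m → ∀ k →
      productOver m (λ mᵢ → ramanujanSum mᵢ k) ≈
      sumOver (divisorTuples m) (λ d → [ lcmᵛ (entries d) ∣? k ] * weight d)
    product-ramanujanSum []       []             k = sym (begin
      [ 1 ∣? k ] * ((1# + 0#) * 1#) + 0#   ≈⟨ +-congʳ (*-congʳ ([]-true (1 ∣? k) (1∣ k))) ⟩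
      1# * ((1# + 0#) * 1#) + 0#           ≈⟨ solve 0 (con (+ 1) :* ((con (+ 1) :+ con (+ 0)) :* con (+ 1)) :+ con (+ 0) := con (+ 1)) refl ⟩
      1#                                   ∎)
    product-ramanujanSum (m ∷ ms) (m≢0 ∷ ms≢0) k = begin
      ramanujanSum m k * productOver ms (λ mᵢ → ramanujanSum mᵢ k)
        ≈⟨ *-cong (ramanujanSum-divisors m k {{m≢0}}) (product-ramanujanSum ms ms≢0 k) ⟩
      sumOver (divisors m) f * sumOver (divisorTuples ms) g
        ≈⟨ sumOver-*-sumOver (divisors m) ⟩
      sumOver (divisors m) (λ d → sumOver (divisorTuples ms) (λ ds → f d * g ds))
        ≈⟨ sumOver-cong (divisors m) (λ d → sumOver-cong (divisorTuples ms) (λ ds → combine d ds)) ⟩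
      sumOver (divisors m) (λ d → sumOver (divisorTuples ms) (λ ds → h (d ∷ ds)))
        ≈⟨ sumOver-cartesianProductWith _∷_ (divisors m) (divisorTuples ms) h ⟨
      sumOver (divisorTuples (m ∷ ms)) h ∎
      where
      f : Divisor m → Carrier
      f (d , d∣m) = [ d ∣? k ] * ((d · 1#) * mob (quotient d∣m))

      g : All Divisor ms → Carrier
      g ds = [ lcmᵛ (entries ds) ∣? k ] * weight ds

      h : All Divisor (m ∷ ms) → Carrier
      h ds = [ lcmᵛ (entries ds) ∣? k ] * weight ds

      sumOver-*-sumOver : ∀ xs → sumOver xs f * sumOver (divisorTuples ms) g ≈
        sumOver xs (λ d → sumOver (divisorTuples ms) (λ ds → f d * g ds))
      sumOver-*-sumOver []       = zeroˡ _
      sumOver-*-sumOver (x ∷ xs) = trans (distribʳ _ _ _)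
        (+-cong (sym (sumOver-*ˡ (divisorTuples ms) (f x) g)) (sumOver-*-sumOver xs))

      combine : ∀ d ds → f d * g ds ≈ h (d ∷ ds)
      combine (d , d∣m) ds = begin
        ([ d ∣? k ] * ((d · 1#) * mob q)) * ([ L ∣? k ] * ((P · 1#) * ι Q))
          ≈⟨ solve 6 (λ a b c d e f → (a :* (b :* c)) :* (d :* (e :* f)) := (a :* d) :* ((b :* e) :* (c :* f))) refl
               [ d ∣? k ] (d · 1#) (mob q) [ L ∣? k ] (P · 1#) (ι Q) ⟩
        ([ d ∣? k ] * [ L ∣? k ]) * (((d · 1#) * (P · 1#)) * (mob q * ι Q))
          -- The universal property of the lcm merges the divisibility conditions on k into one.
          ≈⟨ *-cong ([]-× (d ∣? k) (L ∣? k) (lcm d L ∣? k) lcm-least (∣-trans (m∣lcm[m,n] d L)) (∣-trans (n∣lcm[m,n] d L)))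
               (*-cong (sym (×1-homo-* d P)) (sym (ι-* (μ q) Q))) ⟩
        h ((d , d∣m) ∷ ds) ∎
        where
        q P L : ℕ
        q = quotient d∣m
        P = productᵛ (entries ds)
        L = lcmᵛ (entries ds)
        Q : ℤ
        Q = productᵛℤ (Vec.map μ (cofactors ds))

    T-product-ramanujanSum : ∀ {r} (m : Vec ℕ r) → All NonZero m → ∀ M →
      T M (λ k → productOver m (λ mᵢ → ramanujanSum mᵢ k)) ≈
      sumOver (divisorTuples m) (λ d → T M (λ k → [ lcmᵛ (entries d) ∣? k ]) * weight d)
    T-product-ramanujanSum m m≢0 M = begin
      T M (λ k → productOver m (λ mᵢ → ramanujanSum mᵢ k))
        ≈⟨ T-cong M (λ k → product-ramanujanSum m m≢0 k) ⟩
      T M (λ k → sumOver (divisorTuples m) (λ d → [ lcmᵛ (entries d) ∣? k ] * weight d))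
        ≈⟨ S-sumOver-swap M (divisorTuples m) _ ⟩
      sumOver (divisorTuples m) (λ d → T M (λ k → [ lcmᵛ (entries d) ∣? k ] * weight d))
        ≈⟨ sumOver-cong (divisorTuples m) (λ d → S-*ʳ M (weight d) _) ⟩
      sumOver (divisorTuples m) (λ d → T M (λ k → [ lcmᵛ (entries d) ∣? k ]) * weight d) ∎

lcmᵛ-entries-∣ : ∀ {r} {m : Vec ℕ r} (d : All Divisor m) → lcmᵛ (entries d) ∣ lcmᵛ m
lcmᵛ-entries-∣ []                                = 1∣ 1
lcmᵛ-entries-∣ {m = m ∷ ms} ((_ , d∣m) ∷ ds) = lcm-least
  (∣-trans d∣m (m∣lcm[m,n] m (lcmᵛ ms)))
  (∣-trans (lcmᵛ-entries-∣ ds) (n∣lcm[m,n] m (lcmᵛ ms)))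

-- Complex roots of unity and the mean value

module ComplexRoots {c ℓ₁ ℓ₂} (Real : RealNumbers c ℓ₁ ℓ₂)
  (exp : Complex.ℂ Real → Complex.ℂ Real) (isExponential : Complex.IsExponential Real exp)
  (π : RealNumbers.Carrier Real) (isPi : Complex.IsPi Real exp π) where
  open RealNumbers Real
  open Complex Real
  open ComplexRing Real
  open OrderedFieldProperties orderedField
  open IntegerCoefficients commutativeRing
  open ExponentialLaws Real exp isExponential
  open Trigonometry Real exp isExponential
  open RingProperties (CommutativeRing.ring commutativeRing) using (-0#≈0#)
  private
    module ℂ′ where
      open CommutativeRing ℂ-ring public
      open IntegerCoefficients ℂ-ring public
    module Σℂ = FiniteSums ℂ-ring
  open RootsOfUnity ℂ-ring using (IsRootSystem; T-count; module RamanujanSum)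
  open Indicators ℂ-ring using (T; sumOver-*ˡ; sumOver-cong)

  angle : ℕ → ℕ → Carrier
  angle n a = fromℕ 2 * π * fromℕ a * recip n

  -- Both facts about `cis (t + t)` are conditions on sin t; at half the angle t equals π for a = n
  -- and lies in (0, π) for 0 < a < n.
  halfAngle : ℕ → ℕ → Carrier
  halfAngle n a = π * (fromℕ a * recip n)

  angle≈ : ∀ n a → angle n a ≈ halfAngle n a + halfAngle n a
  angle≈ n a = double π (fromℕ a) (recip n)
    where
    double : ∀ p a r → (1# + (1# + 0#)) * p * a * r ≈ p * (a * r) + p * (a * r)
    double = solve 3 (λ p a r → (con (+ 1) :+ (con (+ 1) :+ con (+ 0))) :* p :* a :* r := p :* (a :* r) :+ p :* (a :* r)) refl

  isRootSystem : IsRootSystem (λ n a → cis (angle n a))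
  isRootSystem = record
    { w-0       = λ n → ℂ′.trans (cis-cong (trans (*-congʳ (zeroʳ _)) (zeroˡ _))) cis-0
    ; w-+       = λ n a b → ℂ′.sym (ℂ′.trans (cis-+ (angle n a) (angle n b)) (cis-cong (sym
        (trans (*-congʳ (trans (*-congˡ (fromℕ-+ a b)) (distribˡ _ _ _))) (distribʳ _ _ _)))))
    ; w-full    = λ n → ℂ′.trans (cis-cong (trans (angle≈ n n) (+-cong (full n) (full n))))
        (im-cis≈0⇒cis[t+t]≈1 (proj₁ (proj₂ isPi)))
    ; w-scale   = λ n d a → cis-cong (scale n d a)
    ; w-reduced = λ n a a<n → let (u , eq) = im-cis#0⇒1-cis[t+t]-invertible (proj₂ (proj₂ isPi) _ (positive n a a<n) (below n a a<n)) in
        u , ℂ′.trans (*ℂ-cong (ℂ′.+-congˡ {1ℂ} (ℂ′.-‿cong (cis-cong (angle≈ n a)))) (ℂ′.refl {u})) eq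
    }
    where
    full : ∀ n .{{_ : NonZero n}} → halfAngle n n ≈ π
    full n = trans (*-congˡ (recip-inverseʳ n)) (*-identityʳ π)

    scale : ∀ n d a .{{_ : NonZero n}} .{{_ : NonZero d}} → angle (n ℕ.* d) (a ℕ.* d) ≈ angle n a
    scale n d a = trans (*-cong (*-congˡ (fromℕ-* a d)) (recip-* n d))
      (trans (rearrange (fromℕ 2 * π) (fromℕ a) (fromℕ d) (recip n) (recip d))
        (trans (*-congˡ (recip-inverseʳ d)) (*-identityʳ _)))
      where
      rearrange : ∀ p a d r s → p * (a * d) * (r * s) ≈ p * a * r * (d * s)
      rearrange = solve 5 (λ p a d r s → p :* (a :* d) :* (r :* s) := p :* a :* r :* (d :* s)) refl

    fromℕ>0 : ∀ n .{{_ : NonZero n}} → 0# < fromℕ n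
    fromℕ>0 (suc n) = fromℕ-pos n

    positive : ∀ n a .{{_ : NonZero a}} → a ℕ.< n → 0# < halfAngle n a
    positive n a a<n = *-pos (proj₁ isPi) (*-pos (fromℕ>0 a) (recip-pos n {{ℕ.>-nonZero (ℕ.m<n⇒0<n a<n)}}))

    below : ∀ n a .{{_ : NonZero a}} → a ℕ.< n → halfAngle n a < π
    -- The difference π - πa/n is π(n - a)/n, a product of positive numbers.
    below n a a<n = 0<-⇒< (<-respʳ-≈ difference
      (*-pos (proj₁ isPi) (*-pos (fromℕ>0 (n ℕ.∸ a) {{ℕ.>-nonZero (ℕ.m<n⇒0<n∸m a<n)}}) (recip-pos n {{n≢0}}))))
      where
      n≢0 : NonZero n
      n≢0 = ℕ.>-nonZero (ℕ.m<n⇒0<n a<n)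
      rearrange : ∀ p a b r → p * (b * r) ≈ p * ((a + b) * r) - p * (a * r)
      rearrange = solve 4 (λ p a b r → p :* (b :* r) := p :* ((a :+ b) :* r) :- p :* (a :* r)) refl
      difference : halfAngle n (n ℕ.∸ a) ≈ π - halfAngle n a
      difference = trans (rearrange π (fromℕ a) (fromℕ (n ℕ.∸ a)) (recip n))
        (+-congʳ (trans (*-congˡ (*-congʳ (trans (sym (fromℕ-+ a (n ℕ.∸ a)))
          (reflexive (≡.cong fromℕ (ℕ.m+[n∸m]≡n (ℕ.<⇒≤ a<n))))))) (full n {{n≢0}})))

  open RamanujanSum isRootSystem using (weight; T-product-ramanujanSum)

  -- Reconciles the optimised multiples behind `ι` with the plain ones behind `fromℤ`.
  ofReal-ι : ∀ i → ℂ′.ι i ≈ℂ ofReal (fromℤ i)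
  ofReal-ι (+ n)    = ℂ′.trans (ℂ′.sym (×ᵤ≈× n 1ℂ)) (ofReal-fromℕ n)
    where open MultOptimised ℂ′.semiring using (×ᵤ≈×)
  ofReal-ι -[1+ n ] = ℂ′.trans (ℂ′.-‿cong (ofReal-ι (+ suc n))) (refl , -0#≈0#)

  -- With M = q L the count q cancels against 1/M = (1/q)(1/L), leaving the denominator L = lcm d.
  weighted-count : ∀ {r} {m : Vec ℕ r} (d : All Divisor m) M .{{_ : NonZero M}} (L∣M : lcmᵛ (entries d) ∣ M) →
    ofReal (recip M) *ℂ ((quotient L∣M Σℂ.· 1ℂ) *ℂ weight d) ≈ℂ divisorTerm d
  weighted-count d M L∣M@(divides q M≡qL) = begin
    ofReal (recip M) *ℂ ((q Σℂ.· 1ℂ) *ℂ ((P Σℂ.· 1ℂ) *ℂ ℂ′.ι Q))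
      ≈⟨ *ℂ-cong {ofReal (recip M)} ℂ′.refl (*ℂ-cong (ofReal-fromℕ q) (*ℂ-cong (ofReal-fromℕ P) (ofReal-ι Q))) ⟩
    ofReal (recip M) *ℂ (ofReal (fromℕ q) *ℂ (ofReal (fromℕ P) *ℂ ofReal (fromℤ Q)))
      ≈⟨ *ℂ-cong {ofReal (recip M)} ℂ′.refl (ℂ′.trans (ofReal-* _ _) (*ℂ-cong {ofReal (fromℕ q)} ℂ′.refl (ofReal-* _ _))) ⟨
    ofReal (recip M) *ℂ ofReal (fromℕ q * (fromℕ P * fromℤ Q))
      ≈⟨ ofReal-* _ _ ⟨
    ofReal (recip M * (fromℕ q * (fromℕ P * fromℤ Q)))
      ≈⟨ simplify , refl ⟩
    ofReal (fromℕ P * recip L * fromℤ Q) ∎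
    where
    open SetoidReasoning ℂ′.setoid
    P L : ℕ
    P = productᵛ (entries d)
    L = lcmᵛ (entries d)
    Q : ℤ
    Q = productᵛℤ (Vec.map μ (cofactors d))

    qL≢0 : NonZero (q ℕ.* L)
    qL≢0 = ≡.subst NonZero M≡qL (ℕ.≢-nonZero (ℕ.≢-nonZero⁻¹ M))

    simplify : recip M * (fromℕ q * (fromℕ P * fromℤ Q)) ≈ fromℕ P * recip L * fromℤ Q
    simplify = trans (*-congʳ (trans (reflexive (≡.cong recip M≡qL)) (recip-* q L {{ℕ.m*n≢0⇒m≢0 q {{qL≢0}}}} {{ℕ.m*n≢0⇒n≢0 q {{qL≢0}}}})))
      (trans (rearrange (recip q) (recip L) (fromℕ q) (fromℕ P) (fromℤ Q))
        (trans (*-congʳ (recip-inverseʳ q {{ℕ.m*n≢0⇒m≢0 q {{qL≢0}}}})) (*-identityˡ _)))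
      where
      rearrange : ∀ a b c d e → a * b * (c * (d * e)) ≈ (c * a) * (d * b * e)
      rearrange = solve 5 (λ a b c d e → a :* b :* (c :* (d :* e)) := (c :* a) :* (d :* b :* e)) refl

  open Ramanujan exp π using (E)

  E-formula : ∀ {r} (m : Vec ℕ r) → All NonZero m → ∀ M .{{_ : NonZero M}} → lcmᵛ m ∣ M →
    E M m ≈ℂ ∑ (divisorTuples m) divisorTerm
  E-formula m m≢0 M lcm∣M = begin
    E M m
      ≈⟨ *ℂ-cong {ofReal (recip M)} ℂ′.refl
           (ℂ′.trans (Σℂ.sumOver-applyUpTo suc M _) (T-product-ramanujanSum m m≢0 M)) ⟩
    ofReal (recip M) *ℂ ∑ (divisorTuples m) (λ d → T M (λ k → [ lcmᵛ (entries d) ∣? k ]) *ℂ weight d)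
      ≈⟨ sumOver-*ˡ (divisorTuples m) (ofReal (recip M)) _ ⟨
    ∑ (divisorTuples m) (λ d → ofReal (recip M) *ℂ (T M (λ k → [ lcmᵛ (entries d) ∣? k ]) *ℂ weight d))
      ≈⟨ sumOver-cong (divisorTuples m) (λ d → let L∣M = ∣-trans (lcmᵛ-entries-∣ d) lcm∣M in ℂ′.trans
           (*ℂ-cong {ofReal (recip M)} ℂ′.refl (*ℂ-cong (T-count {{L≢0 L∣M}} L∣M) (ℂ′.refl {weight d})))
           (weighted-count d M L∣M)) ⟩
    ∑ (divisorTuples m) divisorTerm ∎
    where
    open SetoidReasoning ℂ′.setoid
    open Indicators ℂ-ring using ([_])
    L≢0 : ∀ {L} → L ∣ M → NonZero L
    L≢0 L∣M = ℕ.≢-nonZero λ { ≡.refl → ℕ.≢-nonZero⁻¹ M (0∣⇒≡0 L∣M) }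

proposition3 : ∀ {c ℓ₁ ℓ₂} (Real : RealNumbers c ℓ₁ ℓ₂) → let open Complex Real in
    (exp : ℂ → ℂ) → IsExponential exp →
    (π : RealNumbers.Carrier Real) → IsPi exp π →
    let open Ramanujan exp π in
    (r : ℕ) .{{_ : NonZero r}} (m : Vec ℕ r) → All NonZero m →
    (M : ℕ) .{{_ : NonZero M}} → lcmᵛ m ∣ M →
    E M m ≈ℂ ∑ (divisorTuples m) divisorTerm
proposition3 Real exp isExponential π isPi r m m≢0 M lcm∣M =
  ComplexRoots.E-formula Real exp isExponential π isPi m m≢0 M lcm∣M
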